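{- For every choice of the number of additional inputs $q=q(n)\ge 0$, $$L(n,q)\lesssim \frac{192\, n2^n}{\log_2 n},$$ i.e. $L(n,q)\le (1+o(1))\,\frac{192\,n2^n}{\log_2 n}$ as $n\to\infty$.
   Context: For $m\ge 1$, a $k$-CNOT gate on $m$ lines, with distinct control indices $i_1,\dots,i_k$ and a target index $j\notin\{i_1,\dots,i_k\}$, is the map $\mathbb{Z}_2^m\to\mathbb{Z}_2^m$, $\langle x_1,\dots,x_m\rangle\mapsto\langle x_1,\dots,x_j\oplus x_{i_1}\wedge\dots\wedge x_{i_k},\dots,x_m\rangle$. NOT, CNOT and 2-CNOT are the cases $k=0,1,2$. A reversible circuit on $m$ lines is a finite sequence of such gates; it computes the composition $g$ of its gates, and its complexity is its number of gates. A circuit with $n+q$ lines implements $f\colon\mathbb{Z}_2^n\to\mathbb{Z}_2^n$ with $q$ additional inputs if $\psi_{n+q,n}(g(\phi_{n,n+q}(\mathbf x)))=f(\mathbf x)$ for all $\mathbf x\in\mathbb{Z}_2^n$, where $\phi_{n,n+q}$ appends $q$ zero coordinates and $\psi_{n+q,n}$ keeps the first $n$ coordinates. Let $F(n,q)$ be the set of maps $\mathbb{Z}_2^n\to\mathbb{Z}_2^n$ that can be implemented by such a circuit of NOT, CNOT and 2-CNOT gates with $n+q$ inputs. The Shannon function $L(n,q)$ is the maximum, over all $f\in F(n,q)$, of the minimum complexity of a reversible circuit of NOT, CNOT and 2-CNOT gates implementing $f$ with $q$ additional inputs. -}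

module Defs where

open import Data.Bool using (Bool; true; false; _xor_; _∧_)
open import Data.Nat using (ℕ; _+_; _≤_)
open import Data.Fin using (Fin)
open import Data.List using (List; []; _∷_; length; foldl)
open import Data.List.Relation.Unary.Unique.Propositional using (Unique)
open import Data.List.Membership.Propositional using (_∉_)
open import Data.Vec using (Vec; lookup; updateAt; take; replicate; _++_)
open import Data.Product using (Σ; _×_)
open import Relation.Binary.PropositionalEquality using (_≡_)

-- A k-CNOT gate on m lines with k ∈ {0,1,2} (NOT, CNOT, 2-CNOT):
-- distinct control indices, target not among the controls.
record Gate (m : ℕ) : Set where
  constructor gate
  field
    controls   : List (Fin m)
    target     : Fin m
    distinct   : Unique controls
    targetFree : target ∉ controls
    atMostTwo  : length controls ≤ 2

-- conjunction of the control bits (empty conjunction = true, i.e. NOT)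
conj : ∀ {m} → Vec Bool m → List (Fin m) → Bool
conj x []       = true
conj x (i ∷ is) = lookup x i ∧ conj x is

applyGate : ∀ {m} → Gate m → Vec Bool m → Vec Bool m
applyGate g x = updateAt x (Gate.target g) (λ b → b xor conj x (Gate.controls g))

Circuit : ℕ → Set
Circuit m = List (Gate m)

run : ∀ {m} → Circuit m → Vec Bool m → Vec Bool m
run C x = foldl (λ y g → applyGate g y) x C

complexity : ∀ {m} → Circuit m → ℕ
complexity C = length C

φ : ∀ n q → Vec Bool n → Vec Bool (n + q)
φ n q x = x ++ replicate q false

ψ : ∀ n q → Vec Bool (n + q) → Vec Bool n
ψ n q y = take n y

Implements : ∀ n q → Circuit (n + q) → (Vec Bool n → Vec Bool n) → Set
Implements n q C f = ∀ x → ψ n q (run C (φ n q x)) ≡ f x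

InF : ∀ n q → (Vec Bool n → Vec Bool n) → Set
InF n q f = Σ (Circuit (n + q)) (λ C → Implements n q C f)

-- L(n,q) ≤ B  (unfolding of the max-min definition of the Shannon function)
ShannonLE : ℕ → ℕ → ℕ → Set
ShannonLE n q B = ∀ f → InF n q f →
  Σ (Circuit (n + q)) (λ C → Implements n q C f × complexity C ≤ B)

{-# OPTIONS --safe #-}

-- Let m be the number of lines; m ≤ 2 n may be assumed, since with q > n additional inputs the
-- bijection (x , y) ↦ (y ⊕ f x , x) on 2 n lines computes f.  The 2 ^ n inputs are sent to their
-- targets by groups of k ≈ log n / 6 to log n / 3 disjoint transpositions.  The 2 k points of one group
-- have at most 2 ^ (2 k) = o(n) distinct columns, so m CNOT gates clear all other
-- lines, o(m) further gates move the points into a subcube of dimension 1 + log k, and there the k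
-- transpositions are a single NOT gate controlled by the m − O(log k) remaining lines, realised with
-- about 8 m Toffoli gates.  A group thus costs 12 m + o(m) gates, which gives less than
-- 192 n 2 ^ n / log n in total.  When too few pending points remain to form a group, parity matters:
-- every gate on at least 4 lines is a product of an even number of transpositions, and an even product
-- moving few of the relevant points can be shortened to an even product of few transpositions.

module Submission where

open import Defs
open import Data.Bool using (Bool; true; false; not; if_then_else_; _xor_; _∧_)
import Data.Bool.Properties as B
open import Data.Nat using (ℕ; zero; suc; _+_; _*_; _^_; _∸_; _≤_; _<_; _≥_; z≤n; s≤s; ⌊_/2⌋; ⌈_/2⌉)
import Data.Nat as ℕ
import Data.Nat.Properties as ℕₚ
open import Data.Nat.Induction using (<-wellFounded; Acc; acc)
open import Data.Nat.Logarithm using (⌊log₂_⌋; ⌊log₂⌋-mono-≤; ⌊log₂⌊n/2⌋⌋≡⌊log₂n⌋∸1; ⌊log₂[2^n]⌋≡n)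
open import Data.Nat.Tactic.RingSolver using (solve-∀)
open import Data.Fin using (Fin; zero; suc; _↑ˡ_; _↑ʳ_; splitAt; toℕ)
import Data.Fin.Properties as F
open import Data.List using (List; []; _∷_; length; map; reverse; filter; allFin)
  renaming (_++_ to _++ₗ_; take to takeₗ; drop to dropₗ)
import Data.List
import Data.List.Properties as L
open import Data.List.Membership.Propositional using (_∈_; _∉_; find)
import Data.List.Membership.Propositional.Properties as M
open import Data.List.Relation.Unary.Any using (Any; here; there)
import Data.List.Relation.Unary.Any as Any
import Data.List.Relation.Unary.Any.Properties as Anyₚ
open import Data.List.Relation.Unary.All using (All; []; _∷_)
import Data.List.Relation.Unary.All as All
import Data.List.Relation.Unary.All.Properties as Allₚ
open import Data.List.Relation.Unary.AllPairs using ([]; _∷_)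
open import Data.List.Relation.Unary.Unique.Propositional using (Unique)
import Data.List.Relation.Unary.Unique.Propositional.Properties as U
open import Data.Vec using (Vec; []; _∷_; lookup; updateAt; tabulate; take; drop; replicate; zipWith)
  renaming (_++_ to _++ᵥ_)
import Data.Vec.Properties as V
open import Data.Product using (Σ; _×_; _,_; proj₁; proj₂; ∃; ∃₂)
open import Data.Sum using (_⊎_; inj₁; inj₂; [_,_]′)
open import Data.Empty using (⊥-elim)
open import Function using (_∘_; id; case_of_)
open import Relation.Nullary using (¬_; Dec; yes; no; ¬?)
open import Relation.Nullary.Decidable using (decidable-stable)
open import Relation.Binary.PropositionalEquality
  using (_≡_; _≢_; _≗_; refl; sym; trans; cong; cong₂; subst; subst₂; ≢-sym; module ≡-Reasoning)

-- Two costs compete in the choice of `k`. A group pays a term linear in `m` once, so it should be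
-- large; but gathering its `2 k` points one by one costs about `2 k` times the number of distinct
-- columns, which may reach `2 ^ (2 k)`. Demanding `2 ^ (3 k) ≤ n` leaves a whole factor `2 ^ k` to
-- absorb the factor `k` and the constants. Moreover `k` is a power of two, because the points of a
-- group have to fill a subcube; rounding to such a `k` loses a factor 2. The 12 in the cost of a
-- group is 8 for the controlled gate, 2 for the NOT gates that make its controls react to zeros,
-- and 2 for merging equal columns and separating them again. The map `f` need not be injective, and
-- only `2 ^ n` of the `2 ^ m` vectors are inputs. So an even word on all lines is fixed beforehand,
-- and its action prescribes a full target, garbage included, for every input. The synthesis then
-- only has to keep track of inputs that are not yet at their targets; all other vectors may end up
-- anywhere.

_≟ᵥ_ : ∀ {m} (x y : Vec Bool m) → Dec (x ≡ y)
_≟ᵥ_ = V.≡-dec B._≟_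

-- Bit vectors and the invertibility of circuits

lookup-ext : ∀ {m} {x y : Vec Bool m} → (∀ i → lookup x i ≡ lookup y i) → x ≡ y
lookup-ext {x = x} {y} h =
  trans (sym (V.tabulate∘lookup x)) (trans (V.tabulate-cong h) (V.tabulate∘lookup y))

-- A gate is definitionally `add` on its target with the conjunction of its controls, so the laws of
-- `add` are the laws of gates.
add : ∀ {m} → Fin m → Bool → Vec Bool m → Vec Bool m
add t δ x = updateAt x t (_xor δ)

lookup-add : ∀ {m} (t : Fin m) δ x → lookup (add t δ x) t ≡ lookup x t xor δ
lookup-add t δ x = V.lookup∘updateAt t x

lookup-add-≢ : ∀ {m} {i t : Fin m} {δ} x → i ≢ t → lookup (add t δ x) i ≡ lookup x i
lookup-add-≢ {i = i} {t} x i≢t = V.lookup∘updateAt′ i t i≢t x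

add-add : ∀ {m} (t : Fin m) δ ε x → add t ε (add t δ x) ≡ add t (δ xor ε) x
add-add t δ ε x = V.updateAt-updateAt-local t x (B.xor-assoc (lookup x t) δ ε)

add-comm : ∀ {m} {t u : Fin m} {δ ε} x → t ≢ u → add t δ (add u ε x) ≡ add u ε (add t δ x)
add-comm {t = t} {u} x t≢u = V.updateAt-commutes t u t≢u x

add-false : ∀ {m} (t : Fin m) x → add t false x ≡ x
add-false t x = V.updateAt-id-local t x (B.xor-identityʳ _)

add-involutive : ∀ {m} (t : Fin m) δ x → add t δ (add t δ x) ≡ x
add-involutive t δ x =
  trans (add-add t δ δ x) (trans (cong (λ b → add t b x) (B.xor-same δ)) (add-false t x))

conj-cong : ∀ {m} {x y : Vec Bool m} cs → (∀ {i} → i ∈ cs → lookup x i ≡ lookup y i) →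
            conj x cs ≡ conj y cs
conj-cong []       h = refl
conj-cong (c ∷ cs) h = cong₂ _∧_ (h (here refl)) (conj-cong cs (h ∘ there))

conj-++ : ∀ {m} (x : Vec Bool m) cs ds → conj x (cs ++ₗ ds) ≡ conj x cs ∧ conj x ds
conj-++ x []       ds = refl
conj-++ x (c ∷ cs) ds = trans (cong (lookup x c ∧_) (conj-++ x cs ds)) (sym (B.∧-assoc (lookup x c) _ _))

conj-add : ∀ {m} {t : Fin m} {δ} x {cs} → t ∉ cs → conj (add t δ x) cs ≡ conj x cs
conj-add {t = t} {δ} x {cs} t∉ =
  conj-cong {x = add t δ x} cs λ {i} i∈ → lookup-add-≢ {i = i} {t} x λ { refl → t∉ i∈ }

applyGate-involutive : ∀ {m} (g : Gate m) x → applyGate g (applyGate g x) ≡ x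
applyGate-involutive g x =
  trans (cong (λ b → add t b (add t δ x)) (conj-add x (Gate.targetFree g))) (add-involutive t δ x)
  where
  t = Gate.target g
  δ = conj x (Gate.controls g)

run-++ : ∀ {m} (C D : Circuit m) x → run (C ++ₗ D) x ≡ run D (run C x)
run-++ C D x = L.foldl-++ _ x C D

run-reverse : ∀ {m} (C : Circuit m) x → run (reverse C) (run C x) ≡ x
run-reverse []      x = refl
run-reverse (g ∷ C) x = begin
  run (reverse (g ∷ C)) (run C (applyGate g x))               ≡⟨ cong (λ D → run D (run C (applyGate g x))) (L.unfold-reverse g C) ⟩
  run (reverse C ++ₗ g ∷ []) (run C (applyGate g x))          ≡⟨ run-++ (reverse C) (g ∷ []) _ ⟩
  applyGate g (run (reverse C) (run C (applyGate g x)))       ≡⟨ cong (applyGate g) (run-reverse C (applyGate g x)) ⟩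
  applyGate g (applyGate g x)                                 ≡⟨ applyGate-involutive g x ⟩
  x ∎
  where open ≡-Reasoning

run-injective : ∀ {m} (C : Circuit m) {x y} → run C x ≡ run C y → x ≡ y
run-injective C {x} {y} eq =
  trans (sym (run-reverse C x)) (trans (cong (run (reverse C)) eq) (run-reverse C y))

notGate : ∀ {m} → Fin m → Gate m
notGate t = gate [] t [] (λ ()) z≤n

cnotGate : ∀ {m} (c t : Fin m) → t ≢ c → Gate m
cnotGate c t t≢c = gate (c ∷ []) t ([] ∷ []) (λ { (here e) → t≢c e }) (s≤s z≤n)

toffoliGate : ∀ {m} (c d t : Fin m) → c ≢ d → t ≢ c → t ≢ d → Gate m
toffoliGate c d t c≢d t≢c t≢d =
  gate (c ∷ d ∷ []) t ((c≢d ∷ []) ∷ [] ∷ [])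
    (λ { (here e) → t≢c e ; (there (here e)) → t≢d e }) (s≤s (s≤s z≤n))

-- Multi-controlled gates

-- Expresses that the other lines do not depend on `u`. It lets an `add` on a target line be moved
-- past a circuit that does not read that line.
Commutes : ∀ {m} → Fin m → Circuit m → Set
Commutes u C = ∀ δ x → run C (add u δ x) ≡ add u δ (run C x)

applyGate-commutes : ∀ {m} (g : Gate m) {u} → u ≢ Gate.target g → u ∉ Gate.controls g →
                     Commutes u (g ∷ [])
applyGate-commutes g {u} u≢ u∉ δ x =
  trans (cong (λ b → add (Gate.target g) b (add u δ x)) (conj-add x u∉)) (add-comm x (≢-sym u≢))

∷-commutes : ∀ {m} {u : Fin m} g C → Commutes u (g ∷ []) → Commutes u C → Commutes u (g ∷ C)
∷-commutes g C hg hC δ x = trans (cong (run C) (hg δ x)) (hC δ _)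

++-commutes : ∀ {m} {u : Fin m} C D → Commutes u C → Commutes u D → Commutes u (C ++ₗ D)
++-commutes C D hC hD δ x = trans (run-++ C D _)
  (trans (cong (run D) (hC δ x)) (trans (hD δ _) (cong (add _ δ) (sym (run-++ C D x)))))

-- The borrowed lines bs may hold arbitrary values, and garbage is left on them.
record Ladder {m} (cs : List (Fin m)) (t : Fin m) (bs : List (Fin m)) : Set where
  field
    circuit : Circuit m
    target  : ∀ x → lookup (run circuit x) t ≡ lookup x t xor conj x cs
    others  : ∀ x {i} → i ≢ t → i ∉ bs → lookup (run circuit x) i ≡ lookup x i
    avoids  : ∀ {u} → u ≢ t → u ∉ cs → u ∉ bs → Commutes u circuit
    size    : length circuit ≤ 2 * length cs + 1

xor-conj : ∀ a b c k → a xor (c ∧ b) xor (c ∧ (b xor k)) ≡ a xor (c ∧ k)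
xor-conj a b false k = refl
xor-conj a b true  k = cong (a xor_) (trans (sym (B.xor-assoc b b k)) (cong (_xor k) (B.xor-same b)))

module _ {m} {c b t : Fin m} (c≢b : c ≢ b) (t≢c : t ≢ c) (t≢b : t ≢ b) where
  private
    tof : Gate m
    tof = toffoliGate c b t c≢b t≢c t≢b

  -- Conjugating by the ladder makes the second Toffoli gate see b xor conj x cs,
  -- so that together the two add c ∧ conj x cs to line t.
  run-sandwich : ∀ {cs bs} (E : Ladder cs b bs) → c ∉ bs → t ∉ cs → t ∉ bs → ∀ x →
    run (tof ∷ Ladder.circuit E ++ₗ tof ∷ []) x ≡ add t (conj x (c ∷ cs)) (run (Ladder.circuit E) x)
  run-sandwich {cs} E c∉bs t∉cs t∉bs x = begin
    run (tof ∷ D ++ₗ tof ∷ []) x                 ≡⟨ run-++ D (tof ∷ []) (applyGate tof x) ⟩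
    applyGate tof (run D (add t δ x))            ≡⟨ cong (applyGate tof) (Ladder.avoids E t≢b t∉cs t∉bs δ x) ⟩
    applyGate tof (add t δ y)                    ≡⟨ cong (λ a → add t a (add t δ y)) ctrl ⟩
    add t ε (add t δ y)                          ≡⟨ add-add t δ ε y ⟩
    add t (δ xor ε) y                            ≡⟨ cong (λ a → add t a y) δ+ε ⟩
    add t (conj x (c ∷ cs)) y ∎
    where
    open ≡-Reasoning
    D = Ladder.circuit E
    y = run D x
    δ = lookup x c ∧ lookup x b ∧ true
    ε = lookup x c ∧ (lookup x b xor conj x cs)
    ctrl : conj (add t δ y) (c ∷ b ∷ []) ≡ ε
    ctrl = trans (conj-add y {c ∷ b ∷ []} λ { (here e) → t≢c e ; (there (here e)) → t≢b e })
             (cong₂ _∧_ (Ladder.others E x c≢b c∉bs) (trans (B.∧-identityʳ _) (Ladder.target E x)))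
    δ+ε : δ xor ε ≡ conj x (c ∷ cs)
    δ+ε = trans (cong (λ a → (lookup x c ∧ a) xor ε) (B.∧-identityʳ _))
                (xor-conj false (lookup x b) (lookup x c) (conj x cs))

tail-∉ : ∀ {A : Set} {x y : A} {xs} → x ∉ y ∷ xs → x ∉ xs
tail-∉ h = h ∘ there

-- The conjunction of the remaining controls is collected on a borrowed line between two Toffoli
-- gates. Each further control costs two gates and one borrowed line; the innermost one is a CNOT,
-- so one line fewer than controls suffices.
ladder : ∀ {m} (cs : List (Fin m)) t bs → t ∉ cs → t ∉ bs → Unique bs → (∀ {i} → i ∈ cs → i ∉ bs) →
         length cs ≤ suc (length bs) → Ladder cs t bs
ladder [] t bs t∉cs t∉bs ubs dis le = record
  { circuit = notGate t ∷ []
  ; target  = lookup-add t true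
  ; others  = λ x i≢t _ → lookup-add-≢ x i≢t
  ; avoids  = λ u≢t _ _ → applyGate-commutes (notGate t) u≢t (λ ())
  ; size    = s≤s z≤n }
ladder (c ∷ []) t bs t∉cs t∉bs ubs dis le = record
  { circuit = cnotGate c t (t∉cs ∘ here) ∷ []
  ; target  = λ x → lookup-add t (conj x (c ∷ [])) x
  ; others  = λ x i≢t _ → lookup-add-≢ x i≢t
  ; avoids  = λ u≢t u∉cs _ → applyGate-commutes (cnotGate c t (t∉cs ∘ here)) u≢t u∉cs
  ; size    = s≤s z≤n }
ladder (c ∷ c′ ∷ cs) t [] t∉cs t∉bs ubs dis (s≤s ())
ladder (c ∷ cs@(_ ∷ _)) t (b ∷ bs) t∉cs t∉bs (b∉ ∷ ubs) dis (s≤s le) = record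
  { circuit = tof ∷ D ++ₗ tof ∷ []
  ; target  = λ x → trans (cong (λ y → lookup y t) (sandwich x))
                     (trans (lookup-add t (conj x (c ∷ cs)) (run D x)) (cong (_xor _) (Ladder.others E x t≢b (tail-∉ t∉bs))))
  ; others  = λ x i≢t i∉ → trans (cong (λ y → lookup y _) (sandwich x))
                     (trans (lookup-add-≢ (run D x) i≢t) (Ladder.others E x (i∉ ∘ here) (tail-∉ i∉)))
  ; avoids  = λ u≢t u∉cs u∉bs →
      let hg = applyGate-commutes tof u≢t (λ { (here e) → u∉cs (here e) ; (there (here e)) → u∉bs (here e) })
      in ∷-commutes tof (D ++ₗ tof ∷ []) hg
           (++-commutes D (tof ∷ []) (Ladder.avoids E (u∉bs ∘ here) (tail-∉ u∉cs) (tail-∉ u∉bs)) hg)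
  ; size    = size }
  where
  t≢b : t ≢ b
  t≢b = t∉bs ∘ here
  t≢c : t ≢ c
  t≢c = t∉cs ∘ here
  c≢b : c ≢ b
  c≢b = dis (here refl) ∘ here
  E : Ladder cs b bs
  E = ladder cs b bs (λ b∈ → dis (there b∈) (here refl)) (λ b∈ → All.lookup b∉ b∈ refl) ubs
        (λ i∈ → tail-∉ (dis (there i∈))) le
  D = Ladder.circuit E
  tof = toffoliGate c b t c≢b t≢c t≢b
  sandwich = run-sandwich c≢b t≢c t≢b E (tail-∉ (dis (here refl))) (tail-∉ t∉cs) (tail-∉ t∉bs)
  open ℕₚ.≤-Reasoning
  size : suc (length (D ++ₗ tof ∷ [])) ≤ 2 * suc (length cs) + 1
  size = begin
    suc (length (D ++ₗ tof ∷ []))      ≡⟨ cong suc (trans (L.length-++ D) (ℕₚ.+-comm _ 1)) ⟩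
    2 + length D                       ≤⟨ ℕₚ.+-monoʳ-≤ 2 (Ladder.size E) ⟩
    2 + (2 * length cs + 1)            ≡⟨ lemma (length cs) ⟩
    2 * suc (length cs) + 1 ∎
    where
    lemma : ∀ a → 2 + (2 * a + 1) ≡ 2 * suc a + 1
    lemma = solve-∀

Adds : ∀ {m} → List (Fin m) → Fin m → Circuit m → Set
Adds cs t C = ∀ x → run C x ≡ add t (conj x cs) x

-- Undoing the inner ladder restores the borrowed lines.
clean : ∀ {m} (cs : List (Fin m)) t bs → t ∉ cs → t ∉ bs → Unique bs → (∀ {i} → i ∈ cs → i ∉ bs) →
        length cs ≤ suc (length bs) →
        Σ (Circuit m) λ C → Adds cs t C × length C ≤ 4 * length cs + 1
clean [] t bs t∉cs t∉bs ubs dis le = notGate t ∷ [] , (λ x → refl) , s≤s z≤n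
clean (c ∷ []) t bs t∉cs t∉bs ubs dis le =
  cnotGate c t (t∉cs ∘ here) ∷ [] , (λ x → refl) , s≤s z≤n
clean (c ∷ c′ ∷ cs) t [] t∉cs t∉bs ubs dis (s≤s ())
clean (c ∷ cs@(_ ∷ _)) t (b ∷ bs) t∉cs t∉bs (b∉ ∷ ubs) dis (s≤s le) =
  (tof ∷ D ++ₗ tof ∷ []) ++ₗ reverse D , adds , size
  where
  t≢b : t ≢ b
  t≢b = t∉bs ∘ here
  t≢c : t ≢ c
  t≢c = t∉cs ∘ here
  c≢b : c ≢ b
  c≢b = dis (here refl) ∘ here
  E : Ladder cs b bs
  E = ladder cs b bs (λ b∈ → dis (there b∈) (here refl)) (λ b∈ → All.lookup b∉ b∈ refl) ubs
        (λ i∈ → tail-∉ (dis (there i∈))) le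
  D = Ladder.circuit E
  tof = toffoliGate c b t c≢b t≢c t≢b
  sandwich = run-sandwich c≢b t≢c t≢b E (tail-∉ (dis (here refl))) (tail-∉ t∉cs) (tail-∉ t∉bs)
  adds : Adds (c ∷ cs) t ((tof ∷ D ++ₗ tof ∷ []) ++ₗ reverse D)
  adds x = begin
    run ((tof ∷ D ++ₗ tof ∷ []) ++ₗ reverse D) x   ≡⟨ run-++ (tof ∷ D ++ₗ tof ∷ []) (reverse D) x ⟩
    run (reverse D) (run (tof ∷ D ++ₗ tof ∷ []) x) ≡⟨ cong (run (reverse D)) (sandwich x) ⟩
    run (reverse D) (add t δ (run D x))            ≡⟨ cong (run (reverse D)) (Ladder.avoids E t≢b (tail-∉ t∉cs) (tail-∉ t∉bs) δ x) ⟨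
    run (reverse D) (run D (add t δ x))            ≡⟨ run-reverse D _ ⟩
    add t δ x ∎
    where
    open ≡-Reasoning
    δ = conj x (c ∷ cs)
  open ℕₚ.≤-Reasoning
  size : length ((tof ∷ D ++ₗ tof ∷ []) ++ₗ reverse D) ≤ 4 * suc (length cs) + 1
  size = begin
    length ((tof ∷ D ++ₗ tof ∷ []) ++ₗ reverse D)         ≡⟨ L.length-++ (tof ∷ D ++ₗ tof ∷ []) ⟩
    suc (length (D ++ₗ tof ∷ [])) + length (reverse D)    ≡⟨ cong₂ (λ a b → suc a + b) (L.length-++ D) (L.length-reverse D) ⟩
    suc (length D + 1) + length D                         ≤⟨ ℕₚ.+-mono-≤ (s≤s (ℕₚ.+-monoˡ-≤ 1 (Ladder.size E))) (Ladder.size E) ⟩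
    suc ((2 * length cs + 1) + 1) + (2 * length cs + 1)   ≡⟨ lemma (length cs) ⟩
    4 * length cs + 4                                     ≤⟨ ℕₚ.m≤m+n _ 1 ⟩
    4 * length cs + 4 + 1                                 ≡⟨ lemma′ (length cs) ⟩
    4 * suc (length cs) + 1 ∎
    where
    lemma : ∀ a → suc ((2 * a + 1) + 1) + (2 * a + 1) ≡ 4 * a + 4
    lemma = solve-∀
    lemma′ : ∀ a → 4 * a + 4 + 1 ≡ 4 * suc a + 1
    lemma′ = solve-∀

Unique-++⁻ : ∀ {A : Set} (xs : List A) {ys} → Unique (xs ++ₗ ys) →
             Unique xs × Unique ys × (∀ {i} → i ∈ xs → i ∉ ys)
Unique-++⁻ []       u = [] , u , λ ()
Unique-++⁻ (x ∷ xs) (x∉ ∷ u) with Unique-++⁻ xs u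
... | uxs , uys , dis = Allₚ.++⁻ˡ xs x∉ ∷ uxs , uys , λ
  { (here refl) x∈ys → All.lookup (Allₚ.++⁻ʳ xs x∉) x∈ys refl
  ; (there i∈)       → dis i∈ }

module _ {m} (cs ds : List (Fin m)) (t b : Fin m) where

  -- A commutator: `C` adds the conjunction of `cs` to `b`, and `D` adds `b` times that of `ds` to
  -- `t`. Running `D`, `C`, `D`, `C` cancels the unknown value of `b` from `t`, leaves the product
  -- of the two conjunctions there, and restores `b`. The first gate borrows `t ∷ ds`, the second
  -- `cs`; hence the two length conditions.
  multiControl-++ : Unique cs → Unique ds → (∀ {i} → i ∈ cs → i ∉ ds) → t ∉ cs → t ∉ ds →
                    b ∉ cs → b ∉ ds → t ≢ b → length cs ≤ 2 + length ds → length ds ≤ length cs →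
                    Σ (Circuit m) λ C → Adds (cs ++ₗ ds) t C × length C ≤ 8 * (length cs + length ds) + 12
  multiControl-++ ucs uds dis t∉cs t∉ds b∉cs b∉ds t≢b le le′ = (D ++ₗ C) ++ₗ (D ++ₗ C) , adds , size
    where
    first : Σ (Circuit m) λ C → Adds cs b C × length C ≤ 4 * length cs + 1
    first = clean cs b (t ∷ ds) b∉cs (λ { (here e) → t≢b (sym e) ; (there b∈) → b∉ds b∈ })
           (All.tabulate (λ {d∈ refl → t∉ds d∈}) ∷ uds)
           (λ { i∈ (here refl) → t∉cs i∈ ; i∈ (there i∈ds) → dis i∈ i∈ds }) le
    second : Σ (Circuit m) λ D → Adds (b ∷ ds) t D × length D ≤ 4 * suc (length ds) + 1
    second = clean (b ∷ ds) t cs (λ { (here e) → t≢b e ; (there t∈) → t∉ds t∈ }) t∉cs ucs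
           (λ { (here refl) b∈ → b∉cs b∈ ; (there i∈ds) i∈cs → dis i∈cs i∈ds }) (s≤s le′)
    C = proj₁ first
    addsC = proj₁ (proj₂ first)
    sizeC = proj₂ (proj₂ first)
    D = proj₁ second
    addsD = proj₁ (proj₂ second)
    sizeD = proj₂ (proj₂ second)
    adds : Adds (cs ++ₗ ds) t ((D ++ₗ C) ++ₗ (D ++ₗ C))
    adds x = begin
      run ((D ++ₗ C) ++ₗ (D ++ₗ C)) x                    ≡⟨ run-++ (D ++ₗ C) (D ++ₗ C) x ⟩
      run (D ++ₗ C) (run (D ++ₗ C) x)                    ≡⟨ cong (run (D ++ₗ C)) (half x) ⟩
      run (D ++ₗ C) (add b k (add t δ x))                ≡⟨ half (add b k (add t δ x)) ⟩
      add b _ (add t _ (add b k (add t δ x)))            ≡⟨ cong₂ (λ β τ → add b β (add t τ (add b k (add t δ x)))) ctrl-b ctrl-t ⟩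
      add b k (add t ε (add b k (add t δ x)))            ≡⟨ cong (add b k) (add-comm (add t δ x) t≢b) ⟩
      add b k (add b k (add t ε (add t δ x)))            ≡⟨ add-involutive b k _ ⟩
      add t ε (add t δ x)                                ≡⟨ add-add t δ ε x ⟩
      add t (δ xor ε) x                                  ≡⟨ cong (λ a → add t a x) total ⟩
      add t (conj x (cs ++ₗ ds)) x ∎
      where
      open ≡-Reasoning
      k = conj x cs
      l = conj x ds
      δ = lookup x b ∧ l
      ε = (lookup x b xor k) ∧ l
      z = add b k (add t δ x)
      half : ∀ y → run (D ++ₗ C) y ≡ add b (conj y cs) (add t (conj y (b ∷ ds)) y)
      half y = trans (run-++ D C y) (trans (cong (run C) (addsD y))
        (trans (addsC (add t (conj y (b ∷ ds)) y))
          (cong (λ a → add b a (add t (conj y (b ∷ ds)) y)) (conj-add y t∉cs))))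
      ctrl-b : conj z cs ≡ k
      ctrl-b = trans (conj-add (add t δ x) b∉cs) (conj-add x t∉cs)
      ctrl-t : conj z (b ∷ ds) ≡ ε
      ctrl-t = cong₂ _∧_
        (trans (lookup-add b k (add t δ x)) (cong (_xor k) (lookup-add-≢ x (≢-sym t≢b))))
        (trans (conj-add (add t δ x) b∉ds) (conj-add x t∉ds))
      distrib : ∀ β κ λ′ → (β ∧ λ′) xor ((β xor κ) ∧ λ′) ≡ κ ∧ λ′
      distrib β κ false = trans (cong₂ _xor_ (B.∧-zeroʳ β) (B.∧-zeroʳ (β xor κ))) (sym (B.∧-zeroʳ κ))
      distrib β κ true  = trans (cong₂ _xor_ (B.∧-identityʳ β) (B.∧-identityʳ (β xor κ)))
        (trans (sym (B.xor-assoc β β κ)) (trans (cong (_xor κ) (B.xor-same β)) (sym (B.∧-identityʳ κ))))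
      total : δ xor ε ≡ conj x (cs ++ₗ ds)
      total = trans (distrib (lookup x b) k l) (sym (conj-++ x cs ds))
    open ℕₚ.≤-Reasoning
    double : ∀ a c → (4 * suc c + 1) + (4 * a + 1) + ((4 * suc c + 1) + (4 * a + 1)) ≡ 8 * (a + c) + 12
    double = solve-∀
    size : length ((D ++ₗ C) ++ₗ (D ++ₗ C)) ≤ 8 * (length cs + length ds) + 12
    size = begin
      length ((D ++ₗ C) ++ₗ (D ++ₗ C))          ≡⟨ L.length-++ (D ++ₗ C) ⟩
      length (D ++ₗ C) + length (D ++ₗ C)       ≤⟨ ℕₚ.+-mono-≤ size½ size½ ⟩
      _                                         ≡⟨ double (length cs) (length ds) ⟩
      8 * (length cs + length ds) + 12 ∎
      where
      size½ : length (D ++ₗ C) ≤ (4 * suc (length ds) + 1) + (4 * length cs + 1)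
      size½ = ℕₚ.≤-trans (ℕₚ.≤-reflexive (L.length-++ D)) (ℕₚ.+-mono-≤ sizeD sizeC)

-- Each half of the controls serves as the borrowed lines for the other half.
multiControl : ∀ {m} (cs : List (Fin m)) t b → Unique cs → t ∉ cs → b ∉ cs → t ≢ b →
               Σ (Circuit m) λ C → Adds cs t C × length C ≤ 8 * length cs + 12
multiControl {m} cs t b ucs t∉ b∉ t≢b = C , subst (λ zs → Adds zs t C) split adds ,
    ℕₚ.≤-trans size (ℕₚ.≤-reflexive (cong (λ a → 8 * a + 12) (trans (sym (L.length-++ xs)) (cong length split))))
  where
  h = ⌈ length cs /2⌉
  xs = takeₗ h cs
  ys = dropₗ h cs
  split : xs ++ₗ ys ≡ cs
  split = L.take++drop≡id h cs
  ∈ˡ : ∀ {i} → i ∈ xs → i ∈ cs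
  ∈ˡ i∈ = subst (_ ∈_) split (M.∈-++⁺ˡ i∈)
  ∈ʳ : ∀ {i} → i ∈ ys → i ∈ cs
  ∈ʳ i∈ = subst (_ ∈_) split (M.∈-++⁺ʳ xs i∈)
  lenx : length xs ≡ h
  lenx = trans (L.length-take h cs) (ℕₚ.m≤n⇒m⊓n≡m (ℕₚ.⌈n/2⌉≤n (length cs)))
  leny : length ys ≡ ⌊ length cs /2⌋
  leny = trans (L.length-drop h cs) (trans (cong (_∸ h) (sym (ℕₚ.⌊n/2⌋+⌈n/2⌉≡n (length cs)))) (ℕₚ.m+n∸n≡m _ h))
  ⌈⌉≤ : ∀ a → ⌈ a /2⌉ ≤ 2 + ⌊ a /2⌋
  ⌈⌉≤ zero = z≤n
  ⌈⌉≤ (suc zero) = s≤s z≤n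
  ⌈⌉≤ (suc (suc a)) = s≤s (⌈⌉≤ a)
  parts : Unique xs × Unique ys × (∀ {i} → i ∈ xs → i ∉ ys)
  parts = Unique-++⁻ xs (subst Unique (sym split) ucs)
  halves : Σ (Circuit m) λ C → Adds (xs ++ₗ ys) t C × length C ≤ 8 * (length xs + length ys) + 12
  halves = multiControl-++ xs ys t b (proj₁ parts) (proj₁ (proj₂ parts)) (proj₂ (proj₂ parts))
        (t∉ ∘ ∈ˡ) (t∉ ∘ ∈ʳ) (b∉ ∘ ∈ˡ) (b∉ ∘ ∈ʳ) t≢b
        (subst₂ (λ a c → a ≤ 2 + c) (sym lenx) (sym leny) (⌈⌉≤ (length cs)))
        (subst₂ _≤_ (sym leny) (sym lenx) (ℕₚ.⌊n/2⌋≤⌈n/2⌉ (length cs)))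
  C = proj₁ halves
  adds = proj₁ (proj₂ halves)
  size = proj₂ (proj₂ halves)

nots : ∀ {m} → Vec Bool m → List (Fin m) → Circuit m
nots v []       = []
nots v (c ∷ cs) = if lookup v c then nots v cs else notGate c ∷ nots v cs

length-nots : ∀ {m} (v : Vec Bool m) cs → length (nots v cs) ≤ length cs
length-nots v [] = z≤n
length-nots v (c ∷ cs) with lookup v c
... | true  = ℕₚ.m≤n⇒m≤1+n (length-nots v cs)
... | false = s≤s (length-nots v cs)

nots-commutes : ∀ {m} (v : Vec Bool m) cs {u} → u ∉ cs → Commutes u (nots v cs)
nots-commutes v [] u∉ δ x = refl
nots-commutes v (c ∷ cs) u∉ with lookup v c
... | true  = nots-commutes v cs (tail-∉ u∉)
... | false = ∷-commutes (notGate c) (nots v cs) (applyGate-commutes (notGate c) (u∉ ∘ here) (λ ()))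
                (nots-commutes v cs (tail-∉ u∉))

lookup-nots-∉ : ∀ {m} (v : Vec Bool m) cs x {i} → i ∉ cs → lookup (run (nots v cs) x) i ≡ lookup x i
lookup-nots-∉ v [] x i∉ = refl
lookup-nots-∉ v (c ∷ cs) x i∉ with lookup v c
... | true  = lookup-nots-∉ v cs x (tail-∉ i∉)
... | false = trans (lookup-nots-∉ v cs (add c true x) (tail-∉ i∉)) (lookup-add-≢ x (i∉ ∘ here))

lookup-nots : ∀ {m} (v : Vec Bool m) cs x {i} → Unique cs → i ∈ cs →
              lookup (run (nots v cs) x) i ≡ lookup x i xor not (lookup v i)
lookup-nots v (c ∷ cs) x (c∉ ∷ u) (here refl) with lookup v c
... | true  = trans (lookup-nots-∉ v cs x (λ c∈ → All.lookup c∉ c∈ refl)) (sym (B.xor-identityʳ _))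
... | false = trans (lookup-nots-∉ v cs (add c true x) (λ c∈ → All.lookup c∉ c∈ refl)) (lookup-add c true x)
lookup-nots v (c ∷ cs) x (c∉ ∷ u) (there i∈) with lookup v c
... | true  = lookup-nots v cs x u i∈
... | false = trans (lookup-nots v cs (add c true x) u i∈)
                (cong (_xor _) (lookup-add-≢ x λ { refl → All.lookup c∉ i∈ refl }))

conj-true : ∀ {m} (x : Vec Bool m) cs → (∀ {i} → i ∈ cs → lookup x i ≡ true) → conj x cs ≡ true
conj-true x []       h = refl
conj-true x (c ∷ cs) h = cong₂ _∧_ (h (here refl)) (conj-true x cs (h ∘ there))

conj-false : ∀ {m} (x : Vec Bool m) {cs i} → i ∈ cs → lookup x i ≡ false → conj x cs ≡ false
conj-false x {cs = _ ∷ cs} (here refl) eq = cong (_∧ conj x cs) eq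
conj-false x (there i∈) eq = trans (cong (_ ∧_) (conj-false x i∈ eq)) (B.∧-zeroʳ _)

record Toggles {m} (cs : List (Fin m)) (v : Vec Bool m) (t : Fin m) (C : Circuit m) : Set where
  field
    hit  : ∀ x → (∀ {i} → i ∈ cs → lookup x i ≡ lookup v i) → run C x ≡ add t true x
    miss : ∀ x {i} → i ∈ cs → lookup x i ≢ lookup v i → run C x ≡ x

-- NOT gates on the controls where `v` is 0 turn agreement with `v` into all ones and are undone
-- afterwards. They raise the coefficient from 8 to 10.
patternControl : ∀ {m} (cs : List (Fin m)) v t b → Unique cs → t ∉ cs → b ∉ cs → t ≢ b →
                 Σ (Circuit m) λ C → Toggles cs v t C × length C ≤ 10 * length cs + 12
patternControl {m} cs v t b ucs t∉ b∉ t≢b = N ++ₗ C ++ₗ reverse N , record { hit = hit ; miss = miss } , size′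
  where
  unsigned : Σ (Circuit m) λ C → Adds cs t C × length C ≤ 8 * length cs + 12
  unsigned = multiControl cs t b ucs t∉ b∉ t≢b
  C = proj₁ unsigned
  adds = proj₁ (proj₂ unsigned)
  size = proj₂ (proj₂ unsigned)
  N = nots v cs
  spec : ∀ x → run (N ++ₗ C ++ₗ reverse N) x ≡ add t (conj (run N x) cs) x
  spec x = begin
    run (N ++ₗ C ++ₗ reverse N) x                         ≡⟨ run-++ N _ x ⟩
    run (C ++ₗ reverse N) (run N x)                       ≡⟨ run-++ C (reverse N) _ ⟩
    run (reverse N) (run C (run N x))                     ≡⟨ cong (run (reverse N)) (adds (run N x)) ⟩
    run (reverse N) (add t (conj (run N x) cs) (run N x)) ≡⟨ cong (run (reverse N)) (nots-commutes v cs t∉ _ x) ⟨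
    run (reverse N) (run N (add t (conj (run N x) cs) x)) ≡⟨ run-reverse N _ ⟩
    add t (conj (run N x) cs) x ∎
    where open ≡-Reasoning
  xor-not : ∀ a → a xor not a ≡ true
  xor-not false = refl
  xor-not true  = refl
  xor-not-≢ : ∀ a c → a ≢ c → a xor not c ≡ false
  xor-not-≢ false false h = ⊥-elim (h refl)
  xor-not-≢ false true  h = refl
  xor-not-≢ true  false h = refl
  xor-not-≢ true  true  h = ⊥-elim (h refl)
  hit : ∀ x → (∀ {i} → i ∈ cs → lookup x i ≡ lookup v i) → run (N ++ₗ C ++ₗ reverse N) x ≡ add t true x
  hit x h = trans (spec x) (cong (λ a → add t a x) (conj-true (run N x) cs λ {i} i∈ →
    trans (lookup-nots v cs x ucs i∈) (trans (cong (_xor not (lookup v i)) (h i∈)) (xor-not (lookup v i)))))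
  miss : ∀ x {i} → i ∈ cs → lookup x i ≢ lookup v i → run (N ++ₗ C ++ₗ reverse N) x ≡ x
  miss x {i} i∈ ne = trans (spec x) (trans (cong (λ a → add t a x) (conj-false (run N x) i∈
    (trans (lookup-nots v cs x ucs i∈) (xor-not-≢ (lookup x i) (lookup v i) ne)))) (add-false t x))
  open ℕₚ.≤-Reasoning
  total : ∀ a → a + ((8 * a + 12) + a) ≡ 10 * a + 12
  total = solve-∀
  size′ : length (N ++ₗ C ++ₗ reverse N) ≤ 10 * length cs + 12
  size′ = begin
    length (N ++ₗ C ++ₗ reverse N)                     ≡⟨ trans (L.length-++ N) (cong (length N +_) (L.length-++ C)) ⟩
    length N + (length C + length (reverse N))         ≡⟨ cong (λ a → length N + (length C + a)) (L.length-reverse N) ⟩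
    length N + (length C + length N)                   ≤⟨ ℕₚ.+-mono-≤ (length-nots v cs) (ℕₚ.+-mono-≤ size (length-nots v cs)) ⟩
    length cs + ((8 * length cs + 12) + length cs)     ≡⟨ total (length cs) ⟩
    10 * length cs + 12 ∎

-- Moving points into a subcube

allVecs : ∀ n → List (Vec Bool n)
allVecs zero    = [] ∷ []
allVecs (suc n) = map (false ∷_) (allVecs n) ++ₗ map (true ∷_) (allVecs n)

length-allVecs : ∀ n → length (allVecs n) ≡ 2 ^ n
length-allVecs zero    = refl
length-allVecs (suc n) = begin
  length (allVecs (suc n))                                                   ≡⟨ L.length-++ (map (false ∷_) (allVecs n)) ⟩
  length (map (false ∷_) (allVecs n)) + length (map (true ∷_) (allVecs n))   ≡⟨ cong₂ _+_ (half false) (half true) ⟩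
  2 ^ n + 2 ^ n                                                              ≡⟨ cong (2 ^ n +_) (ℕₚ.+-identityʳ (2 ^ n)) ⟨
  2 ^ suc n ∎
  where
  open ≡-Reasoning
  half : ∀ b → length (map (b ∷_) (allVecs n)) ≡ 2 ^ n
  half b = trans (L.length-map (b ∷_) (allVecs n)) (length-allVecs n)

∈-allVecs : ∀ {n} (x : Vec Bool n) → x ∈ allVecs n
∈-allVecs []          = here refl
∈-allVecs (false ∷ x) = M.∈-++⁺ˡ (M.∈-map⁺ (false ∷_) (∈-allVecs x))
∈-allVecs (true ∷ x)  = M.∈-++⁺ʳ _ (M.∈-map⁺ (true ∷_) (∈-allVecs x))

allVecs-unique : ∀ n → Unique (allVecs n)
allVecs-unique zero    = [] ∷ []
allVecs-unique (suc n) =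
  U.++⁺ (U.map⁺ V.∷-injectiveʳ (allVecs-unique n)) (U.map⁺ V.∷-injectiveʳ (allVecs-unique n))
    λ (i∈ , j∈) → case (M.∈-map⁻ (false ∷_) i∈ , M.∈-map⁻ (true ∷_) j∈) of λ
      { ((_ , _ , refl) , (_ , _ , ())) }

lookup-≢ : ∀ {n} {x y : Vec Bool n} → x ≢ y → ∃ λ i → lookup x i ≢ lookup y i
lookup-≢ {x = x} {y} x≢y with F.any? (λ i → ¬? (lookup x i B.≟ lookup y i))
... | yes p = p
... | no ¬p = ⊥-elim (x≢y (lookup-ext λ i → decidable-stable (lookup x i B.≟ lookup y i) λ ne → ¬p (i , ne)))

toggles-others : ∀ {m} {cs : List (Fin m)} {v t C} → Toggles cs v t C → ∀ x {i} → i ≢ t →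
                 lookup (run C x) i ≡ lookup x i
toggles-others {cs = cs} {v} T x {i} i≢t with All.all? (λ j → lookup x j B.≟ lookup v j) cs
... | yes all = trans (cong (λ y → lookup y i) (Toggles.hit T x (All.lookup all))) (lookup-add-≢ x i≢t)
... | no ¬all with find (Allₚ.¬All⇒Any¬ (λ j → lookup x j B.≟ lookup v j) cs ¬all)
...   | j , j∈ , ne = cong (λ y → lookup y i) (Toggles.miss T x j∈ ne)

-- All gates will be CNOT gates controlled by `j`. Points with a 0 there, in particular those
-- already placed in the cube, stay put, while `x`, which has a 1 there, can be rewritten at will on
-- the other lines of `js`.
record Steered {m} (js : List (Fin m)) (j : Fin m) (v x : Vec Bool m) : Set where
  field
    circuit : Circuit m
    size    : length circuit ≤ length js
    idle    : ∀ y → lookup y j ≡ false → run circuit y ≡ y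
    source  : lookup (run circuit x) j ≡ true
    reached : ∀ {i} → i ∈ js → i ≢ j → lookup (run circuit x) i ≡ lookup v i
    keeps   : ∀ {i} → i ≢ j → lookup x i ≡ lookup v i → lookup (run circuit x) i ≡ lookup v i
    others  : ∀ y {i} → i ∉ js → lookup (run circuit y) i ≡ lookup y i

skip : ∀ {m} {js : List (Fin m)} {i j v x} → i ≡ j ⊎ lookup x i ≡ lookup v i →
       Steered js j v x → Steered (i ∷ js) j v x
skip {js = js} {i} {j} {v} {x} done S = record
  { circuit = circuit ; size = ℕₚ.m≤n⇒m≤1+n size ; idle = idle ; source = source
  ; reached = reach ; keeps = keeps ; others = λ y i∉ → others y (tail-∉ i∉) }
  where
  open Steered S
  reach : ∀ {k} → k ∈ i ∷ js → k ≢ j → lookup (run circuit x) k ≡ lookup v k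
  reach (here refl) k≢j = keeps k≢j ([ (λ e → ⊥-elim (k≢j e)) , id ]′ done)
  reach (there k∈)  k≢j = reached k∈ k≢j

flip : ∀ {a b} → a ≢ b → a xor true ≡ b
flip {false} {false} h = ⊥-elim (h refl)
flip {false} {true}  h = refl
flip {true}  {false} h = refl
flip {true}  {true}  h = ⊥-elim (h refl)

prepend : ∀ {m} {js : List (Fin m)} {i j v x} (i≢j : i ≢ j) → lookup x j ≡ true →
          lookup x i ≢ lookup v i → Steered js j v (applyGate (cnotGate j i i≢j) x) →
          Steered (i ∷ js) j v x
prepend {js = js} {i} {j} {v} {x} i≢j xj xi S = record
  { circuit = g ∷ circuit ; size = s≤s size
  ; idle = λ y yj → trans (cong (run circuit) (fixes y yj)) (idle y yj)
  ; source = source ; reached = reach ; keeps = keep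
  ; others = λ y i∉ → trans (others (applyGate g y) (tail-∉ i∉)) (lookup-add-≢ y (i∉ ∘ here)) }
  where
  open Steered S
  g = cnotGate j i i≢j
  fixes : ∀ y → lookup y j ≡ false → applyGate g y ≡ y
  fixes y yj = trans (cong (λ a → add i (a ∧ true) y) yj) (add-false i y)
  x′i : lookup (applyGate g x) i ≡ lookup v i
  x′i = trans (lookup-add i (conj x (j ∷ [])) x)
          (trans (cong (λ a → lookup x i xor (a ∧ true)) xj) (flip xi))
  reach : ∀ {k} → k ∈ i ∷ js → k ≢ j → lookup (run circuit (applyGate g x)) k ≡ lookup v k
  reach (here refl) k≢j = keeps k≢j x′i
  reach (there k∈)  k≢j = reached k∈ k≢j
  keep : ∀ {k} → k ≢ j → lookup x k ≡ lookup v k → lookup (run circuit (applyGate g x)) k ≡ lookup v k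
  keep {k} k≢j xk = keeps k≢j (trans (lookup-add-≢ x λ { refl → xi xk }) xk)

steer : ∀ {m} (js : List (Fin m)) j v x → lookup x j ≡ true → Steered js j v x
steer [] j v x xj = record
  { circuit = [] ; size = z≤n ; idle = λ _ _ → refl ; source = xj
  ; reached = λ () ; keeps = λ _ e → e ; others = λ _ _ → refl }
steer (i ∷ js) j v x xj with i F.≟ j | lookup x i B.≟ lookup v i
... | yes i≡j | _      = skip (inj₁ i≡j) (steer js j v x xj)
... | no _    | yes xi = skip (inj₂ xi) (steer js j v x xj)
... | no i≢j  | no xi  = prepend i≢j xj xi (steer js j v _ (trans (lookup-add-≢ x (≢-sym i≢j)) xj))

-- Serves both as the embedding of an `l`-dimensional subcube and, being definitionally `φ`, as the
-- encoding of inputs.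
pad : ∀ {l} m → Vec Bool l → Vec Bool (l + m)
pad m c = c ++ᵥ replicate m false

cubeLines restLines : ∀ l m → List (Fin (l + m))
cubeLines l m = map (_↑ˡ m) (allFin l)
restLines l m = map (l ↑ʳ_) (allFin m)

data Line l m : Fin (l + m) → Set where
  inCube : ∀ i → Line l m (i ↑ˡ m)
  inRest : ∀ j → Line l m (l ↑ʳ j)

line : ∀ l m i → Line l m i
line l m i with splitAt l i in eq
... | inj₁ j = subst (Line l m) (F.splitAt⁻¹-↑ˡ eq) (inCube j)
... | inj₂ j = subst (Line l m) (F.splitAt⁻¹-↑ʳ eq) (inRest j)

↑ˡ≢↑ʳ : ∀ {l m} (i : Fin l) (j : Fin m) → i ↑ˡ m ≢ l ↑ʳ j
↑ˡ≢↑ʳ {l} {m} i j eq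
  with () ← trans (sym (F.splitAt-↑ˡ l i m)) (trans (cong (splitAt l) eq) (F.splitAt-↑ʳ l m j))

∈-cubeLines : ∀ {l m} (i : Fin l) → i ↑ˡ m ∈ cubeLines l m
∈-cubeLines i = M.∈-map⁺ (_↑ˡ _) (M.∈-allFin i)

∈-restLines : ∀ {l m} (j : Fin m) → l ↑ʳ j ∈ restLines l m
∈-restLines {l} j = M.∈-map⁺ (l ↑ʳ_) (M.∈-allFin j)

∉-cubeLines : ∀ {l m} (j : Fin m) → l ↑ʳ j ∉ cubeLines l m
∉-cubeLines j j∈ with M.∈-map⁻ (_↑ˡ _) j∈
... | i , _ , eq = ↑ˡ≢↑ʳ i j (sym eq)

∉-restLines : ∀ {l m} (i : Fin l) → i ↑ˡ m ∉ restLines l m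
∉-restLines {l} i i∈ with M.∈-map⁻ (l ↑ʳ_) i∈
... | j , _ , eq = ↑ˡ≢↑ʳ i j eq

cubeLines-unique : ∀ l m → Unique (cubeLines l m)
cubeLines-unique l m = U.map⁺ (F.↑ˡ-injective m _ _) (U.allFin⁺ l)

restLines-unique : ∀ l m → Unique (restLines l m)
restLines-unique l m = U.map⁺ (F.↑ʳ-injective l _ _) (U.allFin⁺ m)

length-cubeLines : ∀ l m → length (cubeLines l m) ≡ l
length-cubeLines l m = trans (L.length-map (_↑ˡ m) (allFin l)) (L.length-tabulate id)

length-restLines : ∀ l m → length (restLines l m) ≡ m
length-restLines l m = trans (L.length-map (l ↑ʳ_) (allFin m)) (L.length-tabulate id)

lookup-pad-↑ˡ : ∀ {l m} (c : Vec Bool l) i → lookup (pad m c) (i ↑ˡ m) ≡ lookup c i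
lookup-pad-↑ˡ {m = m} c i = V.lookup-++ˡ c (replicate m false) i

lookup-pad-↑ʳ : ∀ {l m} (c : Vec Bool l) (j : Fin m) → lookup (pad m c) (l ↑ʳ j) ≡ false
lookup-pad-↑ʳ {m = m} c j = trans (V.lookup-++ʳ c (replicate m false) j) (V.lookup-replicate j false)

lookup-take : ∀ {l m} (x : Vec Bool (l + m)) i → lookup (take l x) i ≡ lookup x (i ↑ˡ m)
lookup-take {l} {m} x i =
  trans (sym (V.lookup-++ˡ (take l x) (drop l x) i)) (cong (λ y → lookup y (i ↑ˡ m)) (V.take++drop≡id l x))

pad-injective : ∀ {l m} {c d : Vec Bool l} → pad m c ≡ pad m d → c ≡ d
pad-injective {c = c} {d} eq = V.++-injectiveˡ c d eq

pad-take : ∀ {l m} (x : Vec Bool (l + m)) → (∀ j → lookup x (l ↑ʳ j) ≡ false) → x ≡ pad m (take l x)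
pad-take {l} {m} x h = lookup-ext at
  where
  at : ∀ i → lookup x i ≡ lookup (pad m (take l x)) i
  at i with line l m i
  ... | inCube i = sym (trans (lookup-pad-↑ˡ (take l x) i) (lookup-take x i))
  ... | inRest j = trans (h j) (sym (lookup-pad-↑ʳ (take l x) j))

Supported : ∀ {m} → List (Fin m) → Vec Bool m → Set
Supported W x = ∀ {i} → i ∉ W → lookup x i ≡ false

controlCost : ℕ → ℕ
controlCost l = 10 * l + 12

-- Only the cube lines are controls, so the size depends on `l` and not on the number of lines.
record Detector {l m} (c : Vec Bool l) (j : Fin m) : Set where
  field
    circuit : Circuit (l + m)
    toggles : Toggles (cubeLines l m) (pad m c) (l ↑ʳ j) circuit
    size    : length circuit ≤ controlCost l

  miss-pad : ∀ {d} → d ≢ c → run circuit (pad m d) ≡ pad m d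
  miss-pad {d} d≢c = let i , ne = lookup-≢ d≢c in
    Toggles.miss toggles (pad m d) (∈-cubeLines i)
      (λ eq → ne (trans (sym (lookup-pad-↑ˡ d i)) (trans eq (lookup-pad-↑ˡ c i))))

-- `stays` protects the points already placed, and `others` keeps the points still to come supported
-- on `W`.
record Placed {l m} (W : List (Fin (l + m))) (σ : ℕ) (done : List (Vec Bool l)) (c : Vec Bool l)
              (x : Vec Bool (l + m)) : Set where
  field
    circuit : Circuit (l + m)
    arrives : run circuit x ≡ pad m c
    stays   : ∀ {d} → d ∈ done → run circuit (pad m d) ≡ pad m d
    others  : ∀ y {i} → i ∉ W → lookup (run circuit y) i ≡ lookup y i
    size    : length circuit ≤ σ

record PlacedAll {l m} (P : Vec Bool l → Vec Bool (l + m)) (cs : List (Vec Bool l)) (σ : ℕ) : Set where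
  field
    circuit : Circuit (l + m)
    arrives : ∀ {c} → c ∈ cs → run circuit (P c) ≡ pad m c
    size    : length circuit ≤ σ

module _ {l m : ℕ} {i₀ i₁ : Fin m} (i₀≢i₁ : i₀ ≢ i₁) where
  private
    spare : Fin (l + m)
    spare = l ↑ʳ i₀

    -- A controlled gate on line `j` needs one more line that is neither a control nor the target;
    -- two distinct lines outside the cube provide one for every `j`.
    neighbour : Fin m → Fin m
    neighbour j with j F.≟ i₀
    ... | yes _ = i₁
    ... | no _  = i₀

    neighbour-≢ : ∀ j → l ↑ʳ j ≢ l ↑ʳ neighbour j
    neighbour-≢ j eq with j F.≟ i₀ | F.↑ʳ-injective l j (neighbour j) eq
    ... | yes j≡ | e = i₀≢i₁ (trans (sym j≡) e)
    ... | no j≢  | e = j≢ e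

  detector : ∀ c j → Detector c j
  detector c j = record
    { circuit = proj₁ C ; toggles = proj₁ (proj₂ C)
    ; size = ℕₚ.≤-trans (proj₂ (proj₂ C)) (ℕₚ.≤-reflexive (cong controlCost (length-cubeLines l m))) }
    where
    C = patternControl (cubeLines l m) (pad m c) (l ↑ʳ j) (l ↑ʳ neighbour j)
          (cubeLines-unique l m) (∉-cubeLines j) (∉-cubeLines (neighbour j)) (neighbour-≢ j)

  module _ (W : List (Fin (l + m))) (cube⊆W : ∀ {i} → i ∈ cubeLines l m → i ∈ W) (spare∈W : spare ∈ W) where

    -- CNOT gates controlled by line `j` bring `x` to `pad m c` except for the 1 on `j`, which the
    -- detector of `c` then clears. Points already placed have a 0 on `j` and differ from `c` on the
    -- cube lines, so neither part moves them.
    placeMarked : ∀ {done c x} (j : Fin m) → Supported W x → c ∉ done → lookup x (l ↑ʳ j) ≡ true →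
                  l ↑ʳ j ∈ W → Placed W (length W + controlCost l) done c x
    placeMarked {done} {c} {x} j sup c∉ xj j∈W = record
      { circuit = S.circuit ++ₗ D.circuit
      ; arrives = trans (run-++ S.circuit D.circuit x) (lookup-ext at)
      ; stays   = λ {d} d∈ → trans (run-++ S.circuit D.circuit (pad m d))
          (trans (cong (run D.circuit) (S.idle (pad m d) (lookup-pad-↑ʳ d j)))
                 (D.miss-pad (λ { refl → c∉ d∈ })))
      ; others  = λ y i∉ → trans (cong (λ z → lookup z _) (run-++ S.circuit D.circuit y))
          (trans (toggles-others D.toggles (run S.circuit y) (λ { refl → i∉ j∈W })) (S.others y i∉))
      ; size    = ℕₚ.≤-trans (ℕₚ.≤-reflexive (L.length-++ S.circuit)) (ℕₚ.+-mono-≤ S.size D.size) }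
      where
      module S = Steered (steer W (l ↑ʳ j) (pad m c) x xj)
      module D = Detector (detector c j)
      y = run S.circuit x
      agree : ∀ {i} → i ≢ l ↑ʳ j → lookup y i ≡ lookup (pad m c) i
      agree {i} i≢j with Any.any? (i F.≟_) W
      ... | yes i∈W = S.reached i∈W i≢j
      ... | no i∉W with line l m i
      ...   | inCube k = ⊥-elim (i∉W (cube⊆W (∈-cubeLines k)))
      ...   | inRest k = trans (S.others x i∉W) (trans (sup i∉W) (sym (lookup-pad-↑ʳ c k)))
      toggled : run D.circuit y ≡ add (l ↑ʳ j) true y
      toggled = Toggles.hit D.toggles y λ i∈ → agree λ { refl → ∉-cubeLines j i∈ }
      at : ∀ i → lookup (run D.circuit y) i ≡ lookup (pad m c) i
      at i with i F.≟ l ↑ʳ j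
      ... | yes refl = trans (cong (λ z → lookup z (l ↑ʳ j)) toggled)
              (trans (lookup-add (l ↑ʳ j) true y) (trans (cong (_xor true) S.source) (sym (lookup-pad-↑ʳ c j))))
      ... | no i≢j = trans (toggles-others D.toggles y i≢j) (agree i≢j)

    -- A point inside the cube is first pushed out of it along the spare line.
    place : ∀ {done c x} → Supported W x → c ∉ done → (∀ {d} → d ∈ done → x ≢ pad m d) →
            Placed W (length W + 2 * controlCost l) done c x
    place {done} {c} {x} sup c∉ free with F.any? (λ j → lookup x (l ↑ʳ j) B.≟ true)
    ... | yes (j , xj) = record
      { circuit = P.circuit ; arrives = P.arrives ; stays = P.stays ; others = P.others
      ; size = ℕₚ.≤-trans P.size (ℕₚ.+-monoʳ-≤ (length W) (ℕₚ.m≤m+n (controlCost l) _)) }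
      where
      j∈W : l ↑ʳ j ∈ W
      j∈W with Any.any? ((l ↑ʳ j) F.≟_) W
      ... | yes j∈ = j∈
      ... | no j∉ with () ← trans (sym xj) (sup j∉)
      module P = Placed (placeMarked {done} {c} {x} j sup c∉ xj j∈W)
    ... | no unmarked = record
      { circuit = D.circuit ++ₗ P.circuit
      ; arrives = trans (run-++ D.circuit P.circuit x) P.arrives
      ; stays   = λ {d} d∈ → trans (run-++ D.circuit P.circuit (pad m d))
          (trans (cong (run P.circuit) (D.miss-pad λ { refl → free d∈ x≡ })) (P.stays d∈))
      ; others  = λ y i∉ → trans (cong (λ z → lookup z _) (run-++ D.circuit P.circuit y))
          (trans (P.others (run D.circuit y) i∉) (toggles-others D.toggles y (λ { refl → i∉ spare∈W })))
      ; size    = ℕₚ.≤-trans (ℕₚ.≤-reflexive (L.length-++ D.circuit))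
          (ℕₚ.≤-trans (ℕₚ.+-mono-≤ D.size P.size) (ℕₚ.≤-reflexive (reorder (controlCost l) (length W)))) }
      where
      reorder : ∀ a w → a + (w + a) ≡ w + 2 * a
      reorder = solve-∀
      module D = Detector (detector (take l x) i₀)
      zeros : ∀ j → lookup x (l ↑ʳ j) ≡ false
      zeros j = B.¬-not λ xj → unmarked (j , xj)
      x≡ : x ≡ pad m (take l x)
      x≡ = pad-take x zeros
      y = run D.circuit x
      pushed : lookup y spare ≡ true
      pushed = trans (cong (λ z → lookup z spare)
                 (Toggles.hit D.toggles x (λ {i} _ → cong (λ z → lookup z i) x≡)))
                 (trans (lookup-add spare true x) (cong (_xor true) (zeros i₀)))
      supported : Supported W y
      supported i∉ = trans (toggles-others D.toggles x (λ { refl → i∉ spare∈W })) (sup i∉)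
      module P = Placed (placeMarked {done} {c} {y} i₀ supported c∉ pushed spare∈W)

    -- After each placement `P` is replaced by its image under the new circuit, which stays
    -- injective and supported on `W`. Injectivity guarantees that the next point does not occupy
    -- the place of an earlier one.
    placeAll : ∀ todo done P → (∀ {c d} → P c ≡ P d → c ≡ d) → (∀ c → Supported W (P c)) →
               (∀ {d} → d ∈ done → P d ≡ pad m d) →
               PlacedAll P (todo ++ₗ done) (length todo * (length W + 2 * controlCost l))
    placeAll [] done P inj sup fixed = record { circuit = [] ; arrives = fixed ; size = z≤n }
    placeAll (c ∷ todo) done P inj sup fixed with Any.any? (c ≟ᵥ_) done
    ... | yes c∈ = record
      { circuit = R.circuit
      ; arrives = λ { (here refl) → R.arrives (M.∈-++⁺ʳ todo c∈) ; (there d∈) → R.arrives d∈ }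
      ; size    = ℕₚ.≤-trans R.size (ℕₚ.m≤n+m _ _) }
      where
      remaining : PlacedAll P (todo ++ₗ done) (length todo * (length W + 2 * controlCost l))
      remaining = placeAll todo done P inj sup fixed
      module R = PlacedAll remaining
    ... | no c∉ = record
      { circuit = S.circuit ++ₗ R.circuit
      ; arrives = λ d∈ → trans (run-++ S.circuit R.circuit _) (R.arrives (swap d∈))
      ; size    = ℕₚ.≤-trans (ℕₚ.≤-reflexive (L.length-++ S.circuit)) (ℕₚ.+-mono-≤ S.size R.size) }
      where
      placed : Placed W (length W + 2 * controlCost l) done c (P c)
      placed = place (sup c) c∉
        (λ d∈ eq → c∉ (subst (_∈ done) (sym (inj (trans eq (sym (fixed d∈))))) d∈))
      module S = Placed placed
      swap : ∀ {d} → d ∈ c ∷ todo ++ₗ done → d ∈ todo ++ₗ c ∷ done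
      swap (here refl) = M.∈-++⁺ʳ todo (here refl)
      swap (there d∈) with M.∈-++⁻ todo d∈
      ... | inj₁ d∈todo = M.∈-++⁺ˡ d∈todo
      ... | inj₂ d∈done = M.∈-++⁺ʳ todo (there d∈done)
      remaining : PlacedAll (run S.circuit ∘ P) (todo ++ₗ c ∷ done) (length todo * (length W + 2 * controlCost l))
      remaining = placeAll todo (c ∷ done) (run S.circuit ∘ P) (inj ∘ run-injective S.circuit)
        (λ d i∉ → trans (S.others (P d) i∉) (sup d i∉))
        (λ { (here refl) → S.arrives
           ; (there d∈)  → trans (cong (run S.circuit) (fixed d∈)) (S.stays d∈) })
      module R = PlacedAll remaining

collapse : ∀ {m} → (Fin m → Fin m) → List (Fin m) → Circuit m
collapse rep [] = []
collapse rep (j ∷ js) with rep j F.≟ j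
... | yes _ = collapse rep js
... | no r≢ = cnotGate (rep j) j (≢-sym r≢) ∷ collapse rep js

length-collapse : ∀ {m} (rep : Fin m → Fin m) js → length (collapse rep js) ≤ length js
length-collapse rep [] = z≤n
length-collapse rep (j ∷ js) with rep j F.≟ j
... | yes _ = ℕₚ.m≤n⇒m≤1+n (length-collapse rep js)
... | no _  = s≤s (length-collapse rep js)

collapse-∉ : ∀ {m} (rep : Fin m → Fin m) js x {i} → i ∉ js → lookup (run (collapse rep js) x) i ≡ lookup x i
collapse-∉ rep [] x i∉ = refl
collapse-∉ rep (j ∷ js) x i∉ with rep j F.≟ j
... | yes _ = collapse-∉ rep js x (tail-∉ i∉)
... | no _  = trans (collapse-∉ rep js _ (tail-∉ i∉)) (lookup-add-≢ x (i∉ ∘ here))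

-- By idempotence a representative is never a target, so the control still has its original value
-- when it is added to the equal line `i`.
collapse-zero : ∀ {m} (rep : Fin m → Fin m) → (∀ j → rep (rep j) ≡ rep j) → ∀ js x {i} → Unique js →
                i ∈ js → rep i ≢ i → lookup x i ≡ lookup x (rep i) → lookup (run (collapse rep js) x) i ≡ false
collapse-zero rep idem (j ∷ js) x (j∉ ∷ u) (here refl) r≢ eq with rep j F.≟ j
... | yes e = ⊥-elim (r≢ e)
... | no _  = trans (collapse-∉ rep js _ (λ j∈ → All.lookup j∉ j∈ refl))
    (trans (lookup-add j (conj x (rep j ∷ [])) x)
      (trans (cong₂ _xor_ eq (B.∧-identityʳ _)) (B.xor-same (lookup x (rep j)))))
collapse-zero rep idem (j ∷ js) x (j∉ ∷ u) (there {xs = js} i∈) r≢ eq with rep j F.≟ j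
... | yes _ = collapse-zero rep idem js x u i∈ r≢ eq
... | no rj≢ = collapse-zero rep idem js _ u i∈ r≢
    (trans (lookup-add-≢ x (λ { refl → All.lookup j∉ i∈ refl }))
      (trans eq (sym (lookup-add-≢ x (λ { refl → rj≢ (idem _) })))))

-- Lines on which the points P carry equal columns are merged: at most 2 ^ 2 ^ l distinct columns
-- occur, so after m CNOT gates the points are supported on that many lines.
module _ {l m : ℕ} (default : Fin m) (P : Vec Bool l → Vec Bool m) where
  private
    points : List (Vec Bool l)
    points = allVecs l

    N : ℕ
    N = length points

  column : Fin m → Vec Bool N
  column j = tabulate λ k → lookup (P (Data.List.lookup points k)) j

  column-≡ : ∀ {i j} → column i ≡ column j → ∀ c → lookup (P c) i ≡ lookup (P c) j
  column-≡ {i} {j} eq c = subst (λ d → lookup (P d) i ≡ lookup (P d) j) (sym (Anyₚ.lookup-index c∈)) (begin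
    lookup (P (Data.List.lookup points k)) i   ≡⟨ V.lookup∘tabulate _ k ⟨
    lookup (column i) k                        ≡⟨ cong (λ v → lookup v k) eq ⟩
    lookup (column j) k                        ≡⟨ V.lookup∘tabulate _ k ⟩
    lookup (P (Data.List.lookup points k)) j ∎)
    where
    open ≡-Reasoning
    c∈ = ∈-allVecs c
    k = Any.index c∈

  lineOf : Vec Bool N → Fin m
  lineOf v with F.any? (λ i → column i ≟ᵥ v)
  ... | yes (i , _) = i
  ... | no _        = default

  column-lineOf : ∀ j → column (lineOf (column j)) ≡ column j
  column-lineOf j with F.any? (λ i → column i ≟ᵥ column j)
  ... | yes (i , eq) = eq
  ... | no none      = ⊥-elim (none (j , refl))

  representative : Fin m → Fin m
  representative j = lineOf (column j)

  -- Indexed by all conceivable columns instead of by lines, which makes the length independent of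
  -- `m`.
  representatives : List (Fin m)
  representatives = map lineOf (allVecs N)

  length-representatives : length representatives ≡ 2 ^ 2 ^ l
  length-representatives = trans (L.length-map lineOf (allVecs N))
    (trans (length-allVecs N) (cong (2 ^_) (length-allVecs l)))

  collapseAll : Circuit m
  collapseAll = collapse representative (allFin m)

  length-collapseAll : length collapseAll ≤ m
  length-collapseAll =
    ℕₚ.≤-trans (length-collapse representative (allFin m)) (ℕₚ.≤-reflexive (L.length-tabulate id))

  collapseAll-supported : ∀ c → Supported representatives (run collapseAll (P c))
  collapseAll-supported c {i} i∉ = collapse-zero representative (λ j → cong lineOf (column-lineOf j))
    (allFin m) (P c) (U.allFin⁺ m) (M.∈-allFin i)
    (λ eq → i∉ (subst (_∈ representatives) eq (M.∈-map⁺ lineOf (∈-allVecs (column i)))))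
    (column-≡ (sym (column-lineOf i)) c)

moveCost : ℕ → ℕ → ℕ
moveCost l m = m + 2 ^ l * ((l + suc (2 ^ 2 ^ l)) + 2 * controlCost l)

groupCost : ℕ → ℕ → ℕ
groupCost l m = moveCost l m + (controlCost m + moveCost l m)

moveToCube : ∀ {l m′} (P : Vec Bool l → Vec Bool (l + (2 + m′))) → (∀ {c d} → P c ≡ P d → c ≡ d) →
             Σ (Circuit (l + (2 + m′))) λ C →
               (∀ c → run C (P c) ≡ pad (2 + m′) c) × length C ≤ moveCost l (l + (2 + m′))
moveToCube {l} {m′} P inj = collapseAll spare P ++ₗ R.circuit ,
  (λ c → trans (run-++ (collapseAll spare P) R.circuit (P c))
               (R.arrives (M.∈-++⁺ˡ (∈-allVecs c)))) ,
  ℕₚ.≤-trans (ℕₚ.≤-reflexive (L.length-++ (collapseAll spare P)))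
    (ℕₚ.+-mono-≤ (length-collapseAll spare P) (ℕₚ.≤-trans R.size (ℕₚ.≤-reflexive
      (cong₂ (λ a w → a * (w + 2 * controlCost l)) (length-allVecs l) lengthW))))
  where
  m : ℕ
  m = 2 + m′
  spare : Fin (l + m)
  spare = l ↑ʳ zero
  -- After merging, only representatives carry ones. The cube lines are included because the
  -- destinations are written there, the spare line because points already in the cube leave it
  -- along this line.
  W : List (Fin (l + m))
  W = cubeLines l m ++ₗ spare ∷ representatives spare P
  lengthW : length W ≡ l + suc (2 ^ 2 ^ l)
  lengthW = trans (L.length-++ (cubeLines l m))
    (cong₂ (λ a r → a + suc r) (length-cubeLines l m) (length-representatives spare P))
  P₀ : Vec Bool l → Vec Bool (l + m)
  P₀ c = run (collapseAll spare P) (P c)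
  σ : ℕ
  σ = length (allVecs l) * (length W + 2 * controlCost l)
  all : PlacedAll P₀ (allVecs l ++ₗ []) σ
  all = placeAll {i₀ = zero} {i₁ = suc zero} (λ ()) W M.∈-++⁺ˡ (M.∈-++⁺ʳ (cubeLines l m) (here refl)) (allVecs l) [] P₀
          (inj ∘ run-injective (collapseAll spare P))
          (λ c i∉ → collapseAll-supported spare P c (λ i∈ → i∉ (M.∈-++⁺ʳ (cubeLines l m) (there i∈))))
          (λ ())
  module R = PlacedAll {l} {m} all

-- After the move, all the transpositions are one gate controlled by the vanishing of the rest lines.
record Grouped {l m} (P : Vec Bool (suc l) → Vec Bool m) : Set where
  field
    circuit : Circuit m
    swaps   : ∀ b c → run circuit (P (b ∷ c)) ≡ P (not b ∷ c)
    fixes   : ∀ {x} → (∀ c → x ≢ P c) → run circuit x ≡ x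
    size    : length circuit ≤ groupCost (suc l) m

-- Inside the cube the partners `b ∷ c` and `not b ∷ c` differ in line `zero` only. A vector that is
-- none of the points is sent by `A` outside the cube, since `A` is injective and the points fill
-- the cube; some rest line is then 1 and the gate does not fire.
conjugateToggle : ∀ {l′ m} (P : Vec Bool (2 + l′) → Vec Bool (2 + l′ + m)) (A G : Circuit (2 + l′ + m)) →
  (∀ c → run A (P c) ≡ pad m c) → length A ≤ moveCost (2 + l′) (2 + l′ + m) →
  Toggles (restLines (2 + l′) m) (replicate (2 + l′ + m) false) zero G →
  length G ≤ controlCost (2 + l′ + m) → Grouped P
conjugateToggle {l′} {m} P A G moves sizeA toggles sizeG =
  record { circuit = T ; swaps = swaps ; fixes = fixes ; size = size }
  where
  l : ℕ
  l = 2 + l′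
  rests : List (Fin (l + m))
  rests = restLines l m
  T = A ++ₗ G ++ₗ reverse A
  run-T : ∀ x → run T x ≡ run (reverse A) (run G (run A x))
  run-T x = trans (run-++ A _ x) (run-++ G (reverse A) _)
  rest-zero : ∀ c {i} → i ∈ rests → lookup (pad m c) i ≡ lookup (replicate (l + m) false) i
  rest-zero c i∈ with M.∈-map⁻ (l ↑ʳ_) i∈
  ... | j , _ , refl = trans (lookup-pad-↑ʳ c j) (sym (V.lookup-replicate (l ↑ʳ j) false))
  swaps : ∀ b c → run T (P (b ∷ c)) ≡ P (not b ∷ c)
  swaps b c = begin
    run T (P (b ∷ c))                                ≡⟨ run-T _ ⟩
    run (reverse A) (run G (run A (P (b ∷ c))))      ≡⟨ cong (run (reverse A) ∘ run G) (moves (b ∷ c)) ⟩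
    run (reverse A) (run G (pad m (b ∷ c)))          ≡⟨ cong (run (reverse A)) (Toggles.hit toggles _ (rest-zero (b ∷ c))) ⟩
    run (reverse A) (pad m ((b xor true) ∷ c))       ≡⟨ cong (λ a → run (reverse A) (pad m (a ∷ c))) (B.xor-comm b true) ⟩
    run (reverse A) (pad m (not b ∷ c))              ≡⟨ cong (run (reverse A)) (moves (not b ∷ c)) ⟨
    run (reverse A) (run A (P (not b ∷ c)))          ≡⟨ run-reverse A _ ⟩
    P (not b ∷ c) ∎
    where open ≡-Reasoning
  idle : ∀ {x} → (∀ c → x ≢ P c) → run G (run A x) ≡ run A x
  idle {x} out with F.any? (λ j → lookup (run A x) (l ↑ʳ j) B.≟ true)
  ... | yes (j , yj) = Toggles.miss toggles (run A x) (∈-restLines j) λ eq →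
          case trans (sym yj) (trans eq (V.lookup-replicate (l ↑ʳ j) false)) of λ ()
  ... | no none = ⊥-elim (out (take l (run A x)) (run-injective A
          (trans (pad-take (run A x) (λ j → B.¬-not λ yj → none (j , yj)))
                 (sym (moves (take l (run A x)))))))
  fixes : ∀ {x} → (∀ c → x ≢ P c) → run T x ≡ x
  fixes {x} out = trans (run-T x) (trans (cong (run (reverse A)) (idle out)) (run-reverse A x))
  open ℕₚ.≤-Reasoning
  size : length T ≤ groupCost l (l + m)
  size = begin
    length T                                      ≡⟨ trans (L.length-++ A) (cong (length A +_) (L.length-++ G)) ⟩
    length A + (length G + length (reverse A))    ≡⟨ cong (λ a → length A + (length G + a)) (L.length-reverse A) ⟩
    length A + (length G + length A)              ≤⟨ ℕₚ.+-mono-≤ (sizeA) (ℕₚ.+-mono-≤ sizeG (sizeA)) ⟩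
    groupCost l (l + m) ∎

groupIn : ∀ {l′ m′} (P : Vec Bool (2 + l′) → Vec Bool (2 + l′ + (2 + m′))) →
          (∀ {c d} → P c ≡ P d → c ≡ d) → Grouped P
groupIn {l′} {m′} P inj = conjugateToggle P (proj₁ mover) (proj₁ gates)
  (proj₁ (proj₂ mover)) (proj₂ (proj₂ mover)) (proj₁ (proj₂ gates)) sizeG
  where
  l m : ℕ
  l = 2 + l′
  m = 2 + m′
  mover : Σ (Circuit (l + m)) λ C → (∀ c → run C (P c) ≡ pad m c) × length C ≤ moveCost l (l + m)
  mover = moveToCube P inj
  rests : List (Fin (l + m))
  rests = restLines l m
  -- The extra line of the controlled gate is the cube line `suc zero`, so the cube must have
  -- dimension at least 2.
  gates : Σ (Circuit (l + m)) λ C → Toggles rests (replicate (l + m) false) zero C × length C ≤ 10 * length rests + 12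
  gates = patternControl rests (replicate (l + m) false) zero (suc zero)
        (restLines-unique l m) (∉-restLines {l} {m} zero) (∉-restLines {l} {m} (suc zero)) (λ ())
  sizeG : length (proj₁ gates) ≤ controlCost (l + m)
  sizeG = ℕₚ.≤-trans (proj₂ (proj₂ gates))
    (ℕₚ.≤-trans (ℕₚ.≤-reflexive (cong (λ a → 10 * a + 12) (length-restLines l m)))
      (ℕₚ.+-monoˡ-≤ 12 (ℕₚ.*-monoʳ-≤ 10 (ℕₚ.m≤n+m m l))))

group : ∀ {l m} → 4 + l ≤ m → (P : Vec Bool (2 + l) → Vec Bool m) → (∀ {c d} → P c ≡ P d → c ≡ d) → Grouped P
group {l} {m} le = along (trans (reorder l (proj₁ split)) (proj₂ split))
  where
  split : ∃ λ o → 4 + l + o ≡ m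
  split = ℕₚ.m≤n⇒∃[o]m+o≡n le
  reorder : ∀ l o → 2 + l + (2 + o) ≡ 4 + l + o
  reorder = solve-∀
  along : ∀ {o m} → 2 + l + (2 + o) ≡ m → (P : Vec Bool (2 + l) → Vec Bool m) →
          (∀ {c d} → P c ≡ P d → c ≡ d) → Grouped P
  along refl = groupIn

-- Words of transpositions and their parity

lookup-injective : ∀ {A : Set} {xs : List A} → Unique xs → ∀ {i j} →
                   Data.List.lookup xs i ≡ Data.List.lookup xs j → i ≡ j
lookup-injective (x∉ ∷ u) {zero}  {zero}  eq = refl
lookup-injective (x∉ ∷ u) {zero}  {suc j} eq = ⊥-elim (All.lookup x∉ (M.∈-lookup j) eq)
lookup-injective (x∉ ∷ u) {suc i} {zero}  eq = ⊥-elim (All.lookup x∉ (M.∈-lookup i) (sym eq))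
lookup-injective (x∉ ∷ u) {suc i} {suc j} eq = cong suc (lookup-injective u eq)

fresh : ∀ {A : Set} → ((x y : A) → Dec (x ≡ y)) → ∀ {xs ys : List A} → Unique ys → length xs < length ys →
        ∃ λ y → y ∈ ys × y ∉ xs
fresh {A} _≟_ {xs} {ys} uys lt with Any.any? (λ y → ¬? (Any.any? (y ≟_) xs)) ys
... | yes some = find some
... | no none  = ⊥-elim (clash (F.pigeonhole lt position))
  where
  inside : ∀ {y} → y ∈ ys → y ∈ xs
  inside {y} y∈ = decidable-stable (Any.any? (y ≟_) xs) λ y∉ → none (Any.map (λ { refl → y∉ }) y∈)
  position : Fin (length ys) → Fin (length xs)
  position i = Any.index (inside (M.∈-lookup i))
  clash : ¬ (∃₂ λ i j → i Data.Fin.< j × position i ≡ position j)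
  clash (i , j , i<j , eq) = F.<⇒≢ i<j (lookup-injective uys (begin
    Data.List.lookup ys i                ≡⟨ Anyₚ.lookup-index (inside (M.∈-lookup i)) ⟩
    Data.List.lookup xs (position i)     ≡⟨ cong (Data.List.lookup xs) eq ⟩
    Data.List.lookup xs (position j)     ≡⟨ Anyₚ.lookup-index (inside (M.∈-lookup j)) ⟨
    Data.List.lookup ys j ∎))
    where open ≡-Reasoning

swap : ∀ {m} → Vec Bool m → Vec Bool m → Vec Bool m → Vec Bool m
swap a b x with x ≟ᵥ a
... | yes _ = b
... | no _ with x ≟ᵥ b
...   | yes _ = a
...   | no _  = x

swap-left : ∀ {m} (a b : Vec Bool m) → swap a b a ≡ b
swap-left a b with a ≟ᵥ a
... | yes _ = refl
... | no ne = ⊥-elim (ne refl)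

swap-right : ∀ {m} (a b : Vec Bool m) → swap a b b ≡ a
swap-right a b with b ≟ᵥ a
... | yes e = e
... | no _ with b ≟ᵥ b
...   | yes _ = refl
...   | no ne = ⊥-elim (ne refl)

swap-other : ∀ {m} {a b x : Vec Bool m} → x ≢ a → x ≢ b → swap a b x ≡ x
swap-other {a = a} {b} {x} x≢a x≢b with x ≟ᵥ a
... | yes e = ⊥-elim (x≢a e)
... | no _ with x ≟ᵥ b
...   | yes e = ⊥-elim (x≢b e)
...   | no _  = refl

data SwapView {m} (a b : Vec Bool m) : Vec Bool m → Set where
  left  : SwapView a b a
  right : SwapView a b b
  other : ∀ {x} → x ≢ a → x ≢ b → SwapView a b x

swapView : ∀ {m} (a b x : Vec Bool m) → SwapView a b x
swapView a b x with x ≟ᵥ a | x ≟ᵥ b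
... | yes refl | _        = left
... | no _     | yes refl = right
... | no x≢a   | no x≢b   = other x≢a x≢b

swap-sym : ∀ {m} (a b x : Vec Bool m) → swap a b x ≡ swap b a x
swap-sym a b x with swapView a b x
... | left          = trans (swap-left a b) (sym (swap-right b a))
... | right         = trans (swap-right a b) (sym (swap-left b a))
... | other x≢a x≢b = trans (swap-other x≢a x≢b) (sym (swap-other x≢b x≢a))

swap-involutive : ∀ {m} (a b x : Vec Bool m) → swap a b (swap a b x) ≡ x
swap-involutive a b x with swapView a b x
... | left          = trans (cong (swap a b) (swap-left a b)) (swap-right a b)
... | right         = trans (cong (swap a b) (swap-right a b)) (swap-left a b)
... | other x≢a x≢b = trans (cong (swap a b) (swap-other x≢a x≢b)) (swap-other x≢a x≢b)

swap-injective : ∀ {m} (a b : Vec Bool m) {x y} → swap a b x ≡ swap a b y → x ≡ y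
swap-injective a b {x} {y} eq =
  trans (sym (swap-involutive a b x)) (trans (cong (swap a b) eq) (swap-involutive a b y))

swap-natural : ∀ {m} (σ : Vec Bool m → Vec Bool m) → (∀ {x y} → σ x ≡ σ y → x ≡ y) →
               ∀ a b x → σ (swap a b x) ≡ swap (σ a) (σ b) (σ x)
swap-natural σ inj a b x with swapView a b x
... | left          = trans (cong σ (swap-left a b)) (sym (swap-left (σ a) (σ b)))
... | right         = trans (cong σ (swap-right a b)) (sym (swap-right (σ a) (σ b)))
... | other x≢a x≢b = trans (cong σ (swap-other x≢a x≢b)) (sym (swap-other (x≢a ∘ inj) (x≢b ∘ inj)))

swap-≢ : ∀ {m} {a b x p : Vec Bool m} → a ≢ p → b ≢ p → x ≢ p → swap a b x ≢ p
swap-≢ {a = a} {b} {x} a≢ b≢ x≢ eq with swapView a b x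
... | left          = b≢ (trans (sym (swap-left a b)) eq)
... | right         = a≢ (trans (sym (swap-right a b)) eq)
... | other x≢a x≢b = x≢ (trans (sym (swap-other x≢a x≢b)) eq)

swap-∉ : ∀ {m} {a b x : Vec Bool m} {D} → a ∉ D → b ∉ D → x ∉ D → swap a b x ∉ D
swap-∉ {a = a} {b} {x} {D} a∉ b∉ x∉ s∈ = swap-≢ (avoid a∉) (avoid b∉) (avoid x∉) refl
  where
  avoid : ∀ {y} → y ∉ D → y ≢ swap a b x
  avoid y∉ eq = y∉ (subst (_∈ D) (sym eq) s∈)

-- Both sides are the same 3-cycle. On the right only the outer transposition involves `p`, and the
-- number of letters is unchanged.
swap-cycle : ∀ {m} {p b c : Vec Bool m} → c ≢ p → b ≢ p → c ≢ b → ∀ y →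
             swap p c (swap p b y) ≡ swap p b (swap c b y)
swap-cycle {p = p} {b} {c} c≢p b≢p c≢b y with swapView c b y
... | left  = trans (cong (swap p c) (swap-other c≢p c≢b))
               (trans (swap-right p c) (sym (trans (cong (swap p b) (swap-left c b)) (swap-right p b))))
... | right = trans (cong (swap p c) (swap-right p b))
               (trans (swap-left p c) (sym (trans (cong (swap p b) (swap-right c b)) (swap-other c≢p c≢b))))
... | other y≢c y≢b = outside (y ≟ᵥ p)
  where
  outside : Dec (y ≡ p) → swap p c (swap p b y) ≡ swap p b (swap c b y)
  outside (yes refl) = trans (cong (swap p c) (swap-left p b))
    (trans (swap-other b≢p (≢-sym c≢b)) (sym (trans (cong (swap p b) (swap-other y≢c y≢b)) (swap-left p b))))
  outside (no y≢p) = trans (cong (swap p c) (swap-other y≢p y≢b))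
    (trans (swap-other y≢p y≢c) (sym (trans (cong (swap p b) (swap-other y≢c y≢b)) (swap-other y≢p y≢b))))

Word : ℕ → Set
Word m = List (Vec Bool m × Vec Bool m)

act : ∀ {m} → Word m → Vec Bool m → Vec Bool m
act []            x = x
act ((a , b) ∷ w) x = swap a b (act w x)

odd : ∀ {A : Set} → List A → Bool
odd []       = false
odd (_ ∷ xs) = not (odd xs)

odd-++ : ∀ {A : Set} (xs ys : List A) → odd (xs ++ₗ ys) ≡ odd xs xor odd ys
odd-++ []       ys = refl
odd-++ (x ∷ xs) ys = trans (cong not (odd-++ xs ys)) (B.not-distribˡ-xor (odd xs) (odd ys))

odd-map : ∀ {A C : Set} (f : A → C) xs → odd (map f xs) ≡ odd xs
odd-map f []       = refl
odd-map f (x ∷ xs) = cong not (odd-map f xs)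

act-++ : ∀ {m} (v w : Word m) x → act (v ++ₗ w) x ≡ act v (act w x)
act-++ []            w x = refl
act-++ ((a , b) ∷ v) w x = cong (swap a b) (act-++ v w x)

act-injective : ∀ {m} (w : Word m) {x y} → act w x ≡ act w y → x ≡ y
act-injective []            eq = eq
act-injective ((a , b) ∷ w) eq = act-injective w (swap-injective a b eq)

act-reverse : ∀ {m} (w : Word m) x → act (reverse w) (act w x) ≡ x
act-reverse []            x = refl
act-reverse ((a , b) ∷ w) x = begin
  act (reverse ((a , b) ∷ w)) (swap a b (act w x))            ≡⟨ cong (λ v → act v (swap a b (act w x))) (L.unfold-reverse (a , b) w) ⟩
  act (reverse w ++ₗ (a , b) ∷ []) (swap a b (act w x))       ≡⟨ act-++ (reverse w) ((a , b) ∷ []) _ ⟩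
  act (reverse w) (swap a b (swap a b (act w x)))             ≡⟨ cong (act (reverse w)) (swap-involutive a b (act w x)) ⟩
  act (reverse w) (act w x)                                   ≡⟨ act-reverse w x ⟩
  x ∎
  where open ≡-Reasoning

Outside : ∀ {m} → List (Vec Bool m) → Vec Bool m × Vec Bool m → Set
Outside D (a , b) = a ≢ b × a ∉ D × b ∉ D

Proper : ∀ {m} → Word m → Set
Proper = All (Outside [])

act-∈ : ∀ {m} {D : List (Vec Bool m)} {w} → All (Outside D) w → ∀ {x} → x ∈ D → act w x ≡ x
act-∈ []                     x∈ = refl
act-∈ ((_ , a∉ , b∉) ∷ outs) x∈ =
  trans (cong (swap _ _) (act-∈ outs x∈)) (swap-other (λ { refl → a∉ x∈ }) (λ { refl → b∉ x∈ }))

-- Pulling all occurrences of p to the front of a word, keeping its parity.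
data Peeled {m} (D : List (Vec Bool m)) (p : Vec Bool m) (w : Word m) : Set where
  fixed : ∀ w′ → All (Outside (p ∷ D)) w′ → act w ≗ act w′ → odd w ≡ odd w′ → Peeled D p w
  moved : ∀ b w′ → b ≢ p → b ∉ D → All (Outside (p ∷ D)) w′ →
          act w ≗ act ((p , b) ∷ w′) → odd w ≡ not (odd w′) → Peeled D p w

∉-∷ : ∀ {A : Set} {x y : A} {ys} → x ≢ y → x ∉ ys → x ∉ y ∷ ys
∉-∷ x≢ x∉ (here e)   = x≢ e
∉-∷ x≢ x∉ (there x∈) = x∉ x∈

peel-at : ∀ {m} {D : List (Vec Bool m)} {p c w} → c ≢ p → c ∉ D → Peeled D p w → Peeled D p ((p , c) ∷ w)
peel-at {p = p} {c} c≢p c∉ (fixed w′ out eq par) =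
  moved c w′ c≢p c∉ out (λ x → cong (swap p c) (eq x)) (cong not par)
peel-at {p = p} {c} c≢p c∉ (moved b w′ b≢p b∉ out eq par) with c ≟ᵥ b
... | yes refl = fixed w′ out (λ x → trans (cong (swap p c) (eq x)) (swap-involutive p c _))
                   (trans (cong not par) (B.not-involutive _))
... | no c≢b   = moved b ((c , b) ∷ w′) b≢p b∉ ((c≢b , ∉-∷ c≢p c∉ , ∉-∷ b≢p b∉) ∷ out)
                   (λ x → trans (cong (swap p c) (eq x)) (swap-cycle c≢p b≢p c≢b (act w′ x))) (cong not par)

-- Moving the leading `(p , b)` to the left past `(a , c)` conjugates it: `p` is not affected, and
-- `b` becomes `swap a c b`.
peel-past : ∀ {m} {D : List (Vec Bool m)} {p a c w} → Outside D (a , c) → a ≢ p → c ≢ p → Peeled D p w →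
            Peeled D p ((a , c) ∷ w)
peel-past {a = a} {c} (a≢c , a∉ , c∉) a≢p c≢p (fixed w′ out eq par) =
  fixed ((a , c) ∷ w′) ((a≢c , ∉-∷ a≢p a∉ , ∉-∷ c≢p c∉) ∷ out) (λ x → cong (swap a c) (eq x)) (cong not par)
peel-past {p = p} {a} {c} {w} (a≢c , a∉ , c∉) a≢p c≢p (moved b w′ b≢p b∉ out eq par) =
  moved (swap a c b) ((a , c) ∷ w′) (swap-≢ a≢p c≢p b≢p) (swap-∉ a∉ c∉ b∉)
    ((a≢c , ∉-∷ a≢p a∉ , ∉-∷ c≢p c∉) ∷ out) acts (cong not par)
  where
  acts : ∀ x → swap a c (act w x) ≡ swap p (swap a c b) (swap a c (act w′ x))
  acts x = trans (cong (swap a c) (eq x))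
    (trans (swap-natural (swap a c) (swap-injective a c) p b (act w′ x))
      (cong (λ q → swap q (swap a c b) (swap a c (act w′ x))) (swap-other (≢-sym a≢p) (≢-sym c≢p))))

peel : ∀ {m} (D : List (Vec Bool m)) p {w} → All (Outside D) w → Peeled D p w
peel D p []  = fixed [] [] (λ _ → refl) refl
peel D p {(a , c) ∷ w} (out@(a≢c , a∉ , c∉) ∷ outs) with a ≟ᵥ p | c ≟ᵥ p
... | yes refl | _        = peel-at (≢-sym a≢c) c∉ (peel D p outs)
... | no a≢p   | no c≢p   = peel-past out a≢p c≢p (peel D p outs)
... | no a≢p   | yes refl with peel-at a≢p a∉ (peel D p outs)
...   | fixed w′ out′ eq par             = fixed w′ out′ (λ x → trans (swap-sym a p (act w x)) (eq x)) par
...   | moved b w′ b≢p b∉ out′ eq par    = moved b w′ b≢p b∉ out′ (λ x → trans (swap-sym a p (act w x)) (eq x)) par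

-- `prefix` takes over what `w` does to `E`: the letters of `rest` avoid `E`, so `rest` fixes all of
-- it.
record Stripped {m} (X D : List (Vec Bool m)) (κ : ℕ) (w : Word m) : Set where
  field
    prefix rest : Word m
    E           : List (Vec Bool m)
    X⊆E         : ∀ {x} → x ∈ X → x ∈ E
    D⊆E         : ∀ {x} → x ∈ D → x ∈ E
    proper      : Proper prefix
    outside     : All (Outside E) rest
    acts        : ∀ x → act w x ≡ act prefix (act rest x)
    parity      : odd w ≡ odd prefix xor odd rest
    size        : length prefix ≤ κ

-- If peeling gave a leading letter `(p , b)`, then `w` would send `p` to `b`, as the remaining
-- letters fix `p`. For a fixed point this is impossible, so nothing is collected.
stripFixed : ∀ {m} (X D : List (Vec Bool m)) {w} → All (Outside D) w → (∀ {x} → x ∈ X → act w x ≡ x) →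
             Stripped X D 0 w
stripFixed [] D {w} outs fix = record
  { prefix = [] ; rest = w ; E = D ; X⊆E = λ () ; D⊆E = id ; proper = [] ; outside = outs
  ; acts = λ _ → refl ; parity = refl ; size = z≤n }
stripFixed (p ∷ X) D {w} outs fix with peel D p outs
... | moved b w′ b≢p b∉ out eq par =
  ⊥-elim (b≢p (trans (sym (swap-left p b))
    (trans (cong (swap p b) (sym (act-∈ out (here refl)))) (trans (sym (eq p)) (fix (here refl))))))
... | fixed w′ out eq par = record
  { prefix = S.prefix ; rest = S.rest ; E = S.E
  ; X⊆E = λ { (here refl) → S.D⊆E (here refl) ; (there x∈) → S.X⊆E x∈ } ; D⊆E = S.D⊆E ∘ there
  ; proper = S.proper ; outside = S.outside ; acts = λ x → trans (eq x) (S.acts x)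
  ; parity = trans par S.parity ; size = S.size }
  where
  stripped : Stripped X (p ∷ D) 0 w′
  stripped = stripFixed X (p ∷ D) out λ x∈ → trans (sym (eq _)) (fix (there x∈))
  module S = Stripped stripped

strip : ∀ {m} (X D : List (Vec Bool m)) {w} → All (Outside D) w → Stripped X D (length X) w
strip [] D {w} outs = record
  { prefix = [] ; rest = w ; E = D ; X⊆E = λ () ; D⊆E = id ; proper = [] ; outside = outs
  ; acts = λ _ → refl ; parity = refl ; size = z≤n }
strip (p ∷ X) D {w} outs with peel D p outs
... | fixed w′ out eq par = record
  { prefix = S.prefix ; rest = S.rest ; E = S.E
  ; X⊆E = λ { (here refl) → S.D⊆E (here refl) ; (there x∈) → S.X⊆E x∈ } ; D⊆E = S.D⊆E ∘ there
  ; proper = S.proper ; outside = S.outside ; acts = λ x → trans (eq x) (S.acts x)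
  ; parity = trans par S.parity ; size = ℕₚ.m≤n⇒m≤1+n S.size }
  where
  stripped : Stripped X (p ∷ D) (length X) w′
  stripped = strip X (p ∷ D) out
  module S = Stripped stripped
... | moved b w′ b≢p b∉ out eq par = record
  { prefix = (p , b) ∷ S.prefix ; rest = S.rest ; E = S.E
  ; X⊆E = λ { (here refl) → S.D⊆E (here refl) ; (there x∈) → S.X⊆E x∈ } ; D⊆E = S.D⊆E ∘ there
  ; proper = (≢-sym b≢p , (λ ()) , (λ ())) ∷ S.proper ; outside = S.outside
  ; acts = λ x → trans (eq x) (cong (swap p b) (S.acts x))
  ; parity = trans par (trans (cong not S.parity) (B.not-distribˡ-xor (odd S.prefix) (odd S.rest)))
  ; size = s≤s S.size }
  where
  stripped : Stripped X (p ∷ D) (length X) w′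
  stripped = strip X (p ∷ D) out
  module S = Stripped stripped

outside-proper : ∀ {m} {D : List (Vec Bool m)} {w} → All (Outside D) w → Proper w
outside-proper = All.map λ (a≢b , _) → a≢b , (λ ()) , (λ ())

-- An even word can be shortened as soon as only few of the points of interest are moved; if the
-- shortened word is odd, a transposition of two irrelevant points is left over to repair its parity.
shorten : ∀ {m} (X Y : List (Vec Bool m)) {w} → Proper w → odd w ≡ false → (∀ {x} → x ∈ X → act w x ≡ x) →
          ∃ λ v → Proper v × odd v ≡ false × length v ≤ suc (length Y) ×
                  (∀ {x} → x ∈ X ⊎ x ∈ Y → act v x ≡ act w x)
shorten {m} X Y {w} proper even fix = repair S.prefix S.rest refl S.proper S.outside S.size parity acts
  where
  stripX : Stripped X [] 0 w
  stripX = stripFixed X [] proper fix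
  module R = Stripped stripX
  prefix≡[] : R.prefix ≡ []
  prefix≡[] with R.prefix | R.size
  ... | [] | _ = refl
  stripY : Stripped Y R.E (length Y) R.rest
  stripY = strip Y R.E R.outside
  module S = Stripped stripY
  parity : odd S.prefix xor odd S.rest ≡ false
  parity = trans (sym S.parity) (trans (cong (λ v → odd v xor odd R.rest) (sym prefix≡[])) (trans (sym R.parity) even))
  acts : ∀ {x} → x ∈ S.E → act S.prefix x ≡ act w x
  acts {x} x∈ = trans (cong (act S.prefix) (sym (act-∈ S.outside x∈)))
    (trans (sym (S.acts x)) (trans (cong (λ v → act v (act R.rest x)) (sym prefix≡[])) (sym (R.acts x))))
  ∈E : ∀ {x} → x ∈ X ⊎ x ∈ Y → x ∈ S.E
  ∈E (inj₁ x∈) = S.D⊆E (R.X⊆E x∈)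
  ∈E (inj₂ x∈) = S.X⊆E x∈
  repair : ∀ v u → S.rest ≡ u → Proper v → All (Outside S.E) u → length v ≤ length Y →
           odd v xor odd u ≡ false → (∀ {x} → x ∈ S.E → act v x ≡ act w x) →
           ∃ λ v → Proper v × odd v ≡ false × length v ≤ suc (length Y) ×
                   (∀ {x} → x ∈ X ⊎ x ∈ Y → act v x ≡ act w x)
  repair v u _ pv ou le par av with odd v in eq
  repair v u _ pv ou le par av | false = v , pv , eq , ℕₚ.m≤n⇒m≤1+n le , λ x∈ → av (∈E x∈)
  repair v [] _ pv ou le () av | true
  repair v ((d , d′) ∷ u) _ pv (out ∷ _) le par av | true =
    v ++ₗ (d , d′) ∷ [] , Allₚ.++⁺ pv (outside-proper (out ∷ [])) ,
    trans (odd-++ v ((d , d′) ∷ [])) (cong (_xor true) eq) ,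
    ℕₚ.≤-trans (ℕₚ.≤-reflexive (trans (L.length-++ v) (ℕₚ.+-comm _ 1))) (s≤s le) ,
    λ x∈ → trans (act-++ v ((d , d′) ∷ []) _)
      (trans (cong (act v) (act-∈ (out ∷ []) (∈E x∈))) (av (∈E x∈)))

-- Selection sort: one transposition brings the present image of `p` home. Points already home are
-- neither `p` nor its image, by injectivity, and stay there.
sortWord : ∀ {m} (π : Vec Bool m → Vec Bool m) → (∀ {x y} → π x ≡ π y → x ≡ y) → ∀ X →
           ∃ λ w → Proper w × (∀ {x} → x ∈ X → act w (π x) ≡ x)
sortWord π inj []      = [] , [] , λ ()
sortWord {m} π inj (p ∷ X) = extend (sortWord π inj X)
  where
  extend : (∃ λ w → Proper w × (∀ {x} → x ∈ X → act w (π x) ≡ x)) →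
           ∃ λ w → Proper w × (∀ {x} → x ∈ p ∷ X → act w (π x) ≡ x)
  extend (w , proper , sorts) with act w (π p) ≟ᵥ p
  ... | yes e = w , proper , λ { (here refl) → e ; (there x∈) → sorts x∈ }
  ... | no q≢p = (act w (π p) , p) ∷ w , (q≢p , (λ ()) , (λ ())) ∷ proper , λ
    { (here refl) → swap-left (act w (π p)) p
    ; (there x∈)  → trans (cong (swap (act w (π p)) p) (sorts x∈)) (swap-other
        (λ x≡q → q≢p (subst (λ z → act w (π z) ≡ z) (inj (act-injective w (trans (sorts x∈) x≡q))) (sorts x∈)))
        (λ { refl → q≢p (sorts x∈) })) }

word : ∀ {m} (π : Vec Bool m → Vec Bool m) → (∀ {x y} → π x ≡ π y → x ≡ y) → ∃ λ w → Proper w × act w ≗ π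
word {m} π inj = reversed (sortWord π inj (allVecs m))
  where
  reversed : (∃ λ w → Proper w × (∀ {x} → x ∈ allVecs m → act w (π x) ≡ x)) → ∃ λ w → Proper w × act w ≗ π
  reversed (w , proper , sorts) = reverse w , All.tabulate (All.lookup proper ∘ Anyₚ.reverse⁻) ,
    λ x → trans (cong (act (reverse w)) (sym (sorts (∈-allVecs x)))) (act-reverse w (π x))

-- Circuits act as even words

EvenWord : ∀ {m} → (Vec Bool m → Vec Bool m) → Set
EvenWord π = ∃ λ w → Proper w × odd w ≡ false × act w ≗ π

conjugate : ∀ {m} → (Vec Bool m → Vec Bool m) → Word m → Word m
conjugate σ = map λ (a , b) → σ a , σ b

act-conjugate : ∀ {m} (σ : Vec Bool m → Vec Bool m) → (∀ {x y} → σ x ≡ σ y → x ≡ y) →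
                ∀ w x → act (conjugate σ w) (σ x) ≡ σ (act w x)
act-conjugate σ inj []            x = refl
act-conjugate σ inj ((a , b) ∷ w) x =
  trans (cong (swap (σ a) (σ b)) (act-conjugate σ inj w x)) (sym (swap-natural σ inj a b (act w x)))

conjugate-proper : ∀ {m} (σ : Vec Bool m → Vec Bool m) → (∀ {x y} → σ x ≡ σ y → x ≡ y) →
                   ∀ {w} → Proper w → Proper (conjugate σ w)
conjugate-proper σ inj proper = Allₚ.map⁺ (All.map (λ (a≢b , _) → a≢b ∘ inj , (λ ()) , (λ ())) proper)

-- A gate not involving line u is the product of its restriction to u = 0 and a conjugate of it.
module _ {m} (g : Gate m) (u : Fin m) (u≢ : u ≢ Gate.target g) (u∉ : u ∉ Gate.controls g) where
  private
    flipᵤ : Vec Bool m → Vec Bool m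
    flipᵤ = add u true

    flipᵤ-injective : ∀ {x y} → flipᵤ x ≡ flipᵤ y → x ≡ y
    flipᵤ-injective {x} {y} eq =
      trans (sym (add-involutive u true x)) (trans (cong flipᵤ eq) (add-involutive u true y))

    half : Vec Bool m → Vec Bool m
    half x = if lookup x u then x else applyGate g x

    lookup-gate : ∀ x → lookup (applyGate g x) u ≡ lookup x u
    lookup-gate x = lookup-add-≢ x u≢

    lookup-half : ∀ x → lookup (half x) u ≡ lookup x u
    lookup-half x with lookup x u in eq
    ... | true  = eq
    ... | false = trans (lookup-gate x) eq

    half-true : ∀ {x} → lookup x u ≡ true → half x ≡ x
    half-true {x} eq = cong (λ b → if b then x else applyGate g x) eq

    half-false : ∀ {x} → lookup x u ≡ false → half x ≡ applyGate g x
    half-false {x} eq = cong (λ b → if b then x else applyGate g x) eq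

    half-injective : ∀ {x y} → half x ≡ half y → x ≡ y
    half-injective {x} {y} eq = go (lookup x u) refl
      where
      yᵤ : lookup y u ≡ lookup x u
      yᵤ = trans (sym (lookup-half y)) (trans (cong (λ z → lookup z u) (sym eq)) (lookup-half x))
      go : ∀ b → lookup x u ≡ b → x ≡ y
      go true  xᵤ = trans (sym (half-true xᵤ)) (trans eq (half-true (trans yᵤ xᵤ)))
      go false xᵤ = run-injective (g ∷ []) (trans (sym (half-false xᵤ)) (trans eq (half-false (trans yᵤ xᵤ))))

    halves : ∀ x → half (flipᵤ (half (flipᵤ x))) ≡ applyGate g x
    halves x = go (lookup x u) refl
      where
      go : ∀ b → lookup x u ≡ b → half (flipᵤ (half (flipᵤ x))) ≡ applyGate g x
      go true  xᵤ = trans (cong (half ∘ flipᵤ) (half-false {flipᵤ x} (trans (lookup-add u true x) (cong (_xor true) xᵤ))))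
        (trans (cong (half ∘ flipᵤ) (applyGate-commutes g u≢ u∉ true x))
          (trans (cong half (add-involutive u true (applyGate g x)))
            (half-true {applyGate g x} (trans (lookup-gate x) xᵤ))))
      go false xᵤ = trans (cong (half ∘ flipᵤ) (half-true {flipᵤ x} (trans (lookup-add u true x) (cong (_xor true) xᵤ))))
        (trans (cong half (add-involutive u true x)) (half-false {x} xᵤ))

  -- A word for `half` and its conjugate have equally many letters, so the product is even whatever
  -- the parity of the first.
  evenGate-avoiding : EvenWord (applyGate g)
  evenGate-avoiding = combine (word half half-injective)
    where
    combine : (∃ λ w → Proper w × act w ≗ half) → EvenWord (applyGate g)
    combine (w , proper , acts) = w ++ₗ conjugate flipᵤ w ,
      Allₚ.++⁺ proper (conjugate-proper flipᵤ flipᵤ-injective proper) ,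
      trans (odd-++ w (conjugate flipᵤ w)) (trans (cong (odd w xor_) (odd-map _ w)) (B.xor-same (odd w))) ,
      λ x → begin
        act (w ++ₗ conjugate flipᵤ w) x                         ≡⟨ act-++ w (conjugate flipᵤ w) x ⟩
        act w (act (conjugate flipᵤ w) x)                       ≡⟨ cong (act w ∘ act (conjugate flipᵤ w)) (add-involutive u true x) ⟨
        act w (act (conjugate flipᵤ w) (flipᵤ (flipᵤ x)))       ≡⟨ cong (act w) (act-conjugate flipᵤ flipᵤ-injective w (flipᵤ x)) ⟩
        act w (flipᵤ (act w (flipᵤ x)))                         ≡⟨ acts _ ⟩
        half (flipᵤ (act w (flipᵤ x)))                          ≡⟨ cong (half ∘ flipᵤ) (acts (flipᵤ x)) ⟩
        half (flipᵤ (half (flipᵤ x)))                           ≡⟨ halves x ⟩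
        applyGate g x ∎
      where open ≡-Reasoning

-- A gate touches at most three lines, so a fourth one is free.
evenGate : ∀ {m} → 4 ≤ m → (g : Gate m) → EvenWord (applyGate g)
evenGate {m} 4≤m g = avoiding (fresh F._≟_ {Gate.target g ∷ Gate.controls g} (U.allFin⁺ m)
    (ℕₚ.≤-trans (s≤s (s≤s (Gate.atMostTwo g))) (ℕₚ.≤-trans 4≤m (ℕₚ.≤-reflexive (sym (L.length-tabulate id))))))
  where
  avoiding : (∃ λ u → u ∈ allFin m × u ∉ Gate.target g ∷ Gate.controls g) → EvenWord (applyGate g)
  avoiding (u , _ , u∉) = evenGate-avoiding g u (u∉ ∘ here) (u∉ ∘ there)

evenCircuit : ∀ {m} → 4 ≤ m → (C : Circuit m) → EvenWord (run C)
evenCircuit 4≤m []      = [] , [] , refl , λ _ → refl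
evenCircuit 4≤m (g ∷ C) = combine (evenGate 4≤m g) (evenCircuit 4≤m C)
  where
  combine : EvenWord (applyGate g) → EvenWord (run C) → EvenWord (run (g ∷ C))
  combine (v , proper-v , even-v , act-v) (w , proper-w , even-w , act-w) =
    w ++ₗ v , Allₚ.++⁺ proper-w proper-v ,
    trans (odd-++ w v) (cong₂ _xor_ even-w even-v) ,
    λ x → trans (act-++ w v x) (trans (cong (act w) (act-v x)) (act-w _))

-- Circuits for short even words

module _ {m} (4≤m : 4 ≤ m) where

  -- The smallest group: the four points become the corners of a 2-dimensional cube, with partners
  -- along the first coordinate.
  disjointPair : ∀ {a b e f : Vec Bool m} → a ≢ b → e ∉ a ∷ b ∷ [] → f ∉ e ∷ a ∷ b ∷ [] →
                 Σ (Circuit m) λ C → (∀ x → run C x ≡ swap a b (swap e f x)) × length C ≤ groupCost 2 m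
  disjointPair {a} {b} {e} {f} a≢b e∉ f∉ = G.circuit , runs , G.size
    where
    P : Vec Bool 2 → Vec Bool m
    P (false ∷ false ∷ []) = a
    P (true  ∷ false ∷ []) = b
    P (false ∷ true  ∷ []) = e
    P (true  ∷ true  ∷ []) = f
    e≢a : e ≢ a
    e≢a = e∉ ∘ here
    e≢b : e ≢ b
    e≢b = e∉ ∘ there ∘ here
    f≢e : f ≢ e
    f≢e = f∉ ∘ here
    f≢a : f ≢ a
    f≢a = f∉ ∘ there ∘ here
    f≢b : f ≢ b
    f≢b = f∉ ∘ there ∘ there ∘ here
    inj : ∀ {c d} → P c ≡ P d → c ≡ d
    inj {false ∷ false ∷ []} {false ∷ false ∷ []} eq = refl
    inj {false ∷ false ∷ []} {true  ∷ false ∷ []} eq = ⊥-elim (a≢b eq)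
    inj {false ∷ false ∷ []} {false ∷ true  ∷ []} eq = ⊥-elim (e≢a (sym eq))
    inj {false ∷ false ∷ []} {true  ∷ true  ∷ []} eq = ⊥-elim (f≢a (sym eq))
    inj {true  ∷ false ∷ []} {false ∷ false ∷ []} eq = ⊥-elim (a≢b (sym eq))
    inj {true  ∷ false ∷ []} {true  ∷ false ∷ []} eq = refl
    inj {true  ∷ false ∷ []} {false ∷ true  ∷ []} eq = ⊥-elim (e≢b (sym eq))
    inj {true  ∷ false ∷ []} {true  ∷ true  ∷ []} eq = ⊥-elim (f≢b (sym eq))
    inj {false ∷ true  ∷ []} {false ∷ false ∷ []} eq = ⊥-elim (e≢a eq)
    inj {false ∷ true  ∷ []} {true  ∷ false ∷ []} eq = ⊥-elim (e≢b eq)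
    inj {false ∷ true  ∷ []} {false ∷ true  ∷ []} eq = refl
    inj {false ∷ true  ∷ []} {true  ∷ true  ∷ []} eq = ⊥-elim (f≢e (sym eq))
    inj {true  ∷ true  ∷ []} {false ∷ false ∷ []} eq = ⊥-elim (f≢a eq)
    inj {true  ∷ true  ∷ []} {true  ∷ false ∷ []} eq = ⊥-elim (f≢b eq)
    inj {true  ∷ true  ∷ []} {false ∷ true  ∷ []} eq = ⊥-elim (f≢e eq)
    inj {true  ∷ true  ∷ []} {true  ∷ true  ∷ []} eq = refl
    grouped : Grouped P
    grouped = group 4≤m P (λ {c} {d} → inj {c} {d})
    module G = Grouped grouped
    runs : ∀ x → run G.circuit x ≡ swap a b (swap e f x)
    runs x with swapView e f x | swapView a b x
    ... | left  | _ = trans (G.swaps false (true ∷ []))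
                        (sym (trans (cong (swap a b) (swap-left e f)) (swap-other f≢a f≢b)))
    ... | right | _ = trans (G.swaps true (true ∷ []))
                        (sym (trans (cong (swap a b) (swap-right e f)) (swap-other e≢a e≢b)))
    ... | other x≢e x≢f | left  = trans (G.swaps false (false ∷ []))
                        (sym (trans (cong (swap a b) (swap-other x≢e x≢f)) (swap-left a b)))
    ... | other x≢e x≢f | right = trans (G.swaps true (false ∷ []))
                        (sym (trans (cong (swap a b) (swap-other x≢e x≢f)) (swap-right a b)))
    ... | other x≢e x≢f | other x≢a x≢b = trans (G.fixes out)
                        (sym (trans (cong (swap a b) (swap-other x≢e x≢f)) (swap-other x≢a x≢b)))
      where
      out : ∀ c → x ≢ P c
      out (false ∷ false ∷ []) = x≢a
      out (true  ∷ false ∷ []) = x≢b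
      out (false ∷ true  ∷ []) = x≢e
      out (true  ∷ true  ∷ []) = x≢f

  -- Two transpositions that may overlap are both paired with the same disjoint one, which cancels.
  pair : ∀ {a b c d : Vec Bool m} → a ≢ b → c ≢ d →
         Σ (Circuit m) λ C → (∀ x → run C x ≡ swap a b (swap c d x)) × length C ≤ groupCost 2 m + groupCost 2 m
  pair {a} {b} {c} {d} a≢b c≢d = first (fresh _≟ᵥ_ {a ∷ b ∷ c ∷ d ∷ []} (allVecs-unique m) (room 4 (ℕₚ.n≤1+n 5)))
    where
    -- There are at least 16 vectors, enough to choose `e` and then `f` apart from the four given
    -- ones.
    room : ∀ k → k < 6 → k < length (allVecs m)
    room k k<6 = ℕₚ.<-≤-trans k<6 (ℕₚ.≤-trans (ℕₚ.≤ᵇ⇒≤ 6 16 _)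
      (ℕₚ.≤-trans (ℕₚ.^-monoʳ-≤ 2 4≤m) (ℕₚ.≤-reflexive (sym (length-allVecs m)))))
    Result : Set
    Result = Σ (Circuit m) λ C → (∀ x → run C x ≡ swap a b (swap c d x)) × length C ≤ groupCost 2 m + groupCost 2 m
    second : ∀ {e} → e ∉ a ∷ b ∷ c ∷ d ∷ [] → (∃ λ f → f ∈ allVecs m × f ∉ e ∷ a ∷ b ∷ c ∷ d ∷ []) → Result
    second {e} e∉ (f , _ , f∉) = combine
      (disjointPair a≢b (λ { (here p) → e∉ (here p) ; (there (here p)) → e∉ (there (here p)) })
        (λ { (here p) → f∉ (here p) ; (there (here p)) → f∉ (there (here p)) ; (there (there (here p))) → f∉ (there (there (here p))) }))
      (disjointPair c≢d (e∉ ∘ there ∘ there)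
        (λ { (here p) → f∉ (here p) ; (there p) → f∉ (there (there (there p))) }))
      where
      combine : (Σ (Circuit m) λ C → (∀ x → run C x ≡ swap a b (swap e f x)) × length C ≤ groupCost 2 m) →
                (Σ (Circuit m) λ C → (∀ x → run C x ≡ swap c d (swap e f x)) × length C ≤ groupCost 2 m) → Result
      combine (C , runC , sizeC) (D , runD , sizeD) = D ++ₗ C , runs ,
        ℕₚ.≤-trans (ℕₚ.≤-reflexive (L.length-++ D)) (ℕₚ.+-mono-≤ sizeD sizeC)
        where
        cancel : ∀ x → swap e f (swap c d (swap e f x)) ≡ swap c d x
        cancel x = trans (swap-natural (swap e f) (swap-injective e f) c d (swap e f x))
          (trans (cong₂ (λ c d → swap c d (swap e f (swap e f x)))
                   (swap-other (λ { refl → e∉ (there (there (here refl))) })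
                               (λ { refl → f∉ (there (there (there (here refl)))) }))
                   (swap-other (λ { refl → e∉ (there (there (there (here refl)))) })
                               (λ { refl → f∉ (there (there (there (there (here refl))))) })))
                 (cong (swap c d) (swap-involutive e f x)))
        runs : ∀ x → run (D ++ₗ C) x ≡ swap a b (swap c d x)
        runs x = trans (run-++ D C x) (trans (runC (run D x))
          (cong (swap a b) (trans (cong (swap e f) (runD x)) (cancel x))))
    first : (∃ λ e → e ∈ allVecs m × e ∉ a ∷ b ∷ c ∷ d ∷ []) → Result
    first (e , _ , e∉) = second e∉ (fresh _≟ᵥ_ (allVecs-unique m) (room 5 ℕₚ.≤-refl))

  wordCircuit : ∀ {v : Word m} → Proper v → odd v ≡ false →
                Σ (Circuit m) λ C → (∀ x → run C x ≡ act v x) × length C ≤ length v * groupCost 2 m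
  wordCircuit [] _ = [] , (λ _ → refl) , z≤n
  wordCircuit {(a , b) ∷ (c , d) ∷ v} ((a≢b , _) ∷ (c≢d , _) ∷ proper) even =
    combine (pair a≢b c≢d) (wordCircuit proper (trans (sym (B.not-involutive (odd v))) even))
    where
    combine : (Σ (Circuit m) λ C → (∀ x → run C x ≡ swap a b (swap c d x)) × length C ≤ groupCost 2 m + groupCost 2 m) →
              (Σ (Circuit m) λ C → (∀ x → run C x ≡ act v x) × length C ≤ length v * groupCost 2 m) →
              Σ (Circuit m) λ C → (∀ x → run C x ≡ swap a b (swap c d (act v x))) ×
                                  length C ≤ (2 + length v) * groupCost 2 m
    combine (C , runC , sizeC) (D , runD , sizeD) = D ++ₗ C ,
      (λ x → trans (run-++ D C x) (trans (runC (run D x)) (cong (swap a b ∘ swap c d) (runD x)))) ,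
      ℕₚ.≤-trans (ℕₚ.≤-reflexive (trans (L.length-++ D) (ℕₚ.+-comm (length D) _)))
        (ℕₚ.≤-trans (ℕₚ.+-mono-≤ sizeC sizeD) (ℕₚ.≤-reflexive (ℕₚ.+-assoc (groupCost 2 m) _ _)))

-- Synthesis by groups of disjoint transpositions

record Removed {A : Set} (y : A) (ys : List A) : Set where
  field
    remaining : List A
    unique    : Unique remaining
    subset    : ∀ {x} → x ∈ remaining → x ∈ ys
    cover     : ∀ {x} → x ∈ ys → x ∈ remaining ⊎ x ≡ y
    size      : length remaining + 1 ≡ length ys

remove : ∀ {A : Set} {y : A} {ys} → Unique ys → y ∈ ys → Removed y ys
remove {ys = _ ∷ ys} (_ ∷ u) (here refl) = record
  { remaining = ys ; unique = u ; subset = there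
  ; cover = λ { (here e) → inj₂ e ; (there x∈) → inj₁ x∈ } ; size = ℕₚ.+-comm (length ys) 1 }
remove {y = y} {ys = z ∷ ys} (z∉ ∷ u) (there y∈) = record
  { remaining = z ∷ R.remaining
  ; unique = All.tabulate (λ x∈ → All.lookup z∉ (R.subset x∈)) ∷ R.unique
  ; subset = λ { (here e) → here e ; (there x∈) → there (R.subset x∈) }
  ; cover = cover
  ; size = cong suc R.size }
  where
  removed : Removed y ys
  removed = remove u y∈
  module R = Removed removed
  cover : ∀ {x} → x ∈ z ∷ ys → x ∈ z ∷ R.remaining ⊎ x ≡ y
  cover (here e) = inj₁ (here e)
  cover (there x∈) with R.cover x∈
  ... | inj₁ x∈′ = inj₁ (there x∈′)
  ... | inj₂ e   = inj₂ e

-- Choosing 2 ^ l points whose transpositions (cur a, goal a) are pairwise disjoint: every value in F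
-- excludes at most one point through cur and one through goal.
module _ {m} (cur goal cur⁻¹ goal⁻¹ : Vec Bool m → Vec Bool m)
         (cur-inv : ∀ x → cur⁻¹ (cur x) ≡ x) (goal-inv : ∀ x → goal⁻¹ (goal x) ≡ x) where

  -- `F` holds the values taken by points picked before. The diagonal is left out of `apart`; there
  -- the caller uses that a picked point is not yet at its goal.
  record Picked (l : ℕ) (F U : List (Vec Bool m)) : Set where
    field
      point     : Vec Bool l → Vec Bool m
      point∈    : ∀ c → point c ∈ U
      cur∉      : ∀ c → cur (point c) ∉ F
      goal∉     : ∀ c → goal (point c) ∉ F
      apart     : ∀ {c d} → c ≢ d → cur (point c) ≢ goal (point d)
      injective : ∀ {c d} → point c ≡ point d → c ≡ d
      remaining : List (Vec Bool m)
      unique    : Unique remaining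
      subset    : ∀ {x} → x ∈ remaining → x ∈ U
      cover     : ∀ {x} → x ∈ U → x ∈ remaining ⊎ ∃ λ c → x ≡ point c
      size      : length remaining + 2 ^ l ≡ length U

  pickOne : ∀ F U → Unique U → length F + length F < length U → Picked 0 F U
  pickOne F U u lt = found (fresh _≟ᵥ_ u (ℕₚ.≤-trans (s≤s (ℕₚ.≤-reflexive
      (trans (L.length-++ (map cur⁻¹ F)) (cong₂ _+_ (L.length-map cur⁻¹ F) (L.length-map goal⁻¹ F))))) lt))
    where
    found : (∃ λ y → y ∈ U × y ∉ map cur⁻¹ F ++ₗ map goal⁻¹ F) → Picked 0 F U
    found (y , y∈ , y∉) = record
      { point = λ _ → y ; point∈ = λ _ → y∈
      ; cur∉ = λ _ c∈ → y∉ (M.∈-++⁺ˡ (subst (_∈ map cur⁻¹ F) (cur-inv y) (M.∈-map⁺ cur⁻¹ c∈)))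
      ; goal∉ = λ _ g∈ → y∉ (M.∈-++⁺ʳ (map cur⁻¹ F) (subst (_∈ map goal⁻¹ F) (goal-inv y) (M.∈-map⁺ goal⁻¹ g∈)))
      ; apart = λ { {[]} {[]} c≢d → ⊥-elim (c≢d refl) } ; injective = λ { {[]} {[]} _ → refl }
      ; remaining = R.remaining ; unique = R.unique ; subset = R.subset
      ; cover = λ x∈ → [ inj₁ , (λ e → inj₂ ([] , e)) ]′ (R.cover x∈)
      ; size = R.size }
      where
      removed : Removed y U
      removed = remove u y∈
      module R = Removed removed

  values : ∀ {l} → (Vec Bool l → Vec Bool m) → List (Vec Bool m)
  values {l} f = map (cur ∘ f) (allVecs l) ++ₗ map (goal ∘ f) (allVecs l)

  length-values : ∀ {l} (f : Vec Bool l → Vec Bool m) → length (values f) ≡ 2 ^ l + 2 ^ l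
  length-values {l} f = trans (L.length-++ (map (cur ∘ f) (allVecs l)))
    (cong₂ _+_ (trans (L.length-map (cur ∘ f) (allVecs l)) (length-allVecs l))
               (trans (L.length-map (goal ∘ f) (allVecs l)) (length-allVecs l)))

  cur∈values : ∀ {l} (f : Vec Bool l → Vec Bool m) c → cur (f c) ∈ values f
  cur∈values f c = M.∈-++⁺ˡ (M.∈-map⁺ (cur ∘ f) (∈-allVecs c))

  goal∈values : ∀ {l} (f : Vec Bool l → Vec Bool m) c → goal (f c) ∈ values f
  goal∈values {l} f c = M.∈-++⁺ʳ (map (cur ∘ f) (allVecs l)) (M.∈-map⁺ (goal ∘ f) (∈-allVecs c))

  join : ∀ {l F U} (P : Picked l F U) → Picked l (values (Picked.point P) ++ₗ F) (Picked.remaining P) →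
         Picked (suc l) F U
  join {l} {F} {U} P Q = record
    { point = point
    ; point∈ = λ { (false ∷ c) → P.point∈ c ; (true ∷ c) → P.subset (Q.point∈ c) }
    ; cur∉ = λ { (false ∷ c) → P.cur∉ c ; (true ∷ c) → Q.cur∉ c ∘ M.∈-++⁺ʳ (values P.point) }
    ; goal∉ = λ { (false ∷ c) → P.goal∉ c ; (true ∷ c) → Q.goal∉ c ∘ M.∈-++⁺ʳ (values P.point) }
    ; apart = λ {c} {d} → apart {c} {d} ; injective = λ {c} {d} → injective {c} {d}
    ; remaining = Q.remaining ; unique = Q.unique ; subset = P.subset ∘ Q.subset
    ; cover = cover
    ; size = trans (regroup (length Q.remaining) (2 ^ l)) (trans (cong (_+ 2 ^ l) Q.size) P.size) }
    where
    module P = Picked P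
    module Q = Picked Q
    regroup : ∀ a k → a + 2 * k ≡ a + k + k
    regroup = solve-∀
    point : Vec Bool (suc l) → Vec Bool m
    point (false ∷ c) = P.point c
    point (true  ∷ c) = Q.point c
    cur-≢ : ∀ {c d} → cur (Q.point c) ≢ cur (P.point d)
    cur-≢ {c} {d} eq = Q.cur∉ c (M.∈-++⁺ˡ (subst (_∈ values P.point) (sym eq) (cur∈values P.point d)))
    apart : ∀ {c d} → c ≢ d → cur (point c) ≢ goal (point d)
    apart {false ∷ c} {false ∷ d} c≢d eq = P.apart (λ e → c≢d (cong (false ∷_) e)) eq
    apart {true  ∷ c} {true  ∷ d} c≢d eq = Q.apart (λ e → c≢d (cong (true ∷_) e)) eq
    apart {false ∷ c} {true  ∷ d} c≢d eq =
      Q.goal∉ d (M.∈-++⁺ˡ (subst (_∈ values P.point) eq (cur∈values P.point c)))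
    apart {true  ∷ c} {false ∷ d} c≢d eq =
      Q.cur∉ c (M.∈-++⁺ˡ (subst (_∈ values P.point) (sym eq) (goal∈values P.point d)))
    injective : ∀ {c d} → point c ≡ point d → c ≡ d
    injective {false ∷ c} {false ∷ d} eq = cong (false ∷_) (P.injective eq)
    injective {true  ∷ c} {true  ∷ d} eq = cong (true ∷_) (Q.injective eq)
    injective {false ∷ c} {true  ∷ d} eq = ⊥-elim (cur-≢ (cong cur (sym eq)))
    injective {true  ∷ c} {false ∷ d} eq = ⊥-elim (cur-≢ (cong cur eq))
    cover : ∀ {x} → x ∈ U → x ∈ Q.remaining ⊎ ∃ λ c → x ≡ point c
    cover x∈ with P.cover x∈
    ... | inj₂ (c , e) = inj₂ (false ∷ c , e)
    ... | inj₁ x∈P with Q.cover x∈P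
    ...   | inj₂ (c , e) = inj₂ (true ∷ c , e)
    ...   | inj₁ x∈Q     = inj₁ x∈Q

  -- The 5 reproduces itself under doubling: each of the first `2 ^ l` points is used up and adds
  -- two values to `F`, each of which excludes up to two further points, and `1 + 2 * 2 = 5`.
  pick : ∀ l F U → Unique U → 2 * length F + 5 * 2 ^ l ≤ length U → Picked l F U
  pick zero F U u le = pickOne F U u (ℕₚ.≤-trans (ℕₚ.m≤n+m _ 4) (ℕₚ.≤-trans (ℕₚ.≤-reflexive (regroup (length F))) le))
    where
    regroup : ∀ a → 4 + suc (a + a) ≡ 2 * a + 5 * 1
    regroup = solve-∀
  pick (suc l) F U u le = join picked (pick l (values P.point ++ₗ F) P.remaining P.unique
      (ℕₚ.+-cancelʳ-≤ (2 ^ l) _ _ (begin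
        2 * length (values P.point ++ₗ F) + 5 * 2 ^ l + 2 ^ l   ≡⟨ cong (λ a → 2 * a + 5 * 2 ^ l + 2 ^ l)
                                                                     (trans (L.length-++ (values P.point)) (cong (_+ length F) (length-values P.point))) ⟩
        2 * (2 ^ l + 2 ^ l + length F) + 5 * 2 ^ l + 2 ^ l      ≡⟨ regroup (length F) (2 ^ l) ⟩
        2 * length F + 5 * 2 ^ suc l                            ≤⟨ le ⟩
        length U                                                ≡⟨ P.size ⟨
        length P.remaining + 2 ^ l ∎)))
    where
    open ℕₚ.≤-Reasoning
    regroup : ∀ a k → 2 * (k + k + a) + 5 * k + k ≡ 2 * a + 5 * (2 * k)
    regroup = solve-∀
    enough : 2 * length F + 5 * 2 ^ l ≤ length U
    enough = ℕₚ.≤-trans (ℕₚ.+-monoʳ-≤ (2 * length F) (ℕₚ.*-monoʳ-≤ 5 (ℕₚ.m≤m+n (2 ^ l) _))) le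
    picked : Picked l F U
    picked = pick l F U u enough
    module P = Picked picked

module _ {m l : ℕ} (4+l≤m : 4 + l ≤ m) (A : List (Vec Bool m)) (w₀ : Word m) (proper : Proper w₀)
         (even : odd w₀ ≡ false) where
  private
    goal : Vec Bool m → Vec Bool m
    goal = act w₀

    4≤m : 4 ≤ m
    4≤m = ℕₚ.≤-trans (ℕₚ.m≤m+n 4 l) 4+l≤m

    k : ℕ
    k = 2 ^ suc l

    G G₂ : ℕ
    G = groupCost (2 + l) m
    G₂ = groupCost 2 m

  Pending : Circuit m → List (Vec Bool m) → Set
  Pending C U = ∀ {a} → a ∈ A → a ∈ U ⊎ run C a ≡ goal a

  Completion : Circuit m → (ℕ → Set) → Set
  Completion C Size = Σ (Circuit m) λ T → (∀ {a} → a ∈ A → run T (run C a) ≡ goal a) × Size (length T)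

  -- What is missing is to undo `C` and then apply `w₀`. This is an even word, because the reverse
  -- of `C` is a circuit, and it fixes the images of all solved inputs, so `shorten` applies with
  -- the images of `U` as the moved points.
  finish : ∀ C U → Pending C U → Completion C λ s → s ≤ suc (length U) * G₂
  finish C U pending = fromBack (evenCircuit 4≤m (reverse C))
    where
    Y X : List (Vec Bool m)
    Y = map (run C) U
    X = map (run C) (filter (λ a → run C a ≟ᵥ goal a) A)
    Result : Set
    Result = Completion C λ s → s ≤ suc (length U) * G₂
    fromBack : EvenWord (run (reverse C)) → Result
    fromBack (w₁ , proper₁ , even₁ , act₁) =
      fromShort (shorten X Y {w} (Allₚ.++⁺ proper proper₁) (trans (odd-++ w₀ w₁) (cong₂ _xor_ even even₁)) fixes)
      where
      w : Word m
      w = w₀ ++ₗ w₁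
      act-w : ∀ a → act w (run C a) ≡ goal a
      act-w a = trans (act-++ w₀ w₁ (run C a)) (cong goal (trans (act₁ (run C a)) (run-reverse C a)))
      fixes : ∀ {x} → x ∈ X → act w x ≡ x
      fixes x∈ with M.∈-map⁻ (run C) x∈
      ... | a , a∈ , refl = trans (act-w a) (sym (proj₂ (M.∈-filter⁻ (λ a → run C a ≟ᵥ goal a) {xs = A} a∈)))
      tracked : ∀ {a} → a ∈ A → run C a ∈ X ⊎ run C a ∈ Y
      tracked a∈ with pending a∈
      ... | inj₁ a∈U = inj₂ (M.∈-map⁺ (run C) a∈U)
      ... | inj₂ e   = inj₁ (M.∈-map⁺ (run C) (M.∈-filter⁺ (λ a → run C a ≟ᵥ goal a) a∈ e))
      fromShort : (∃ λ v → Proper v × odd v ≡ false × length v ≤ suc (length Y) ×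
                           (∀ {x} → x ∈ X ⊎ x ∈ Y → act v x ≡ act w x)) → Result
      fromShort (v , proper-v , even-v , len , acts) = fromCircuit (wordCircuit 4≤m proper-v even-v)
        where
        fromCircuit : (Σ (Circuit m) λ T → (∀ x → run T x ≡ act v x) × length T ≤ length v * G₂) → Result
        fromCircuit (T , runs , size) = T ,
          (λ {a} a∈ → trans (runs (run C a)) (trans (acts (tracked a∈)) (act-w a))) ,
          ℕₚ.≤-trans size (ℕₚ.*-monoˡ-≤ G₂ (ℕₚ.≤-trans len (s≤s (ℕₚ.≤-reflexive (L.length-map (run C) U)))))

  record Advanced (C : Circuit m) (U : List (Vec Bool m)) : Set where
    field
      circuit   : Circuit m
      size      : length circuit ≤ G
      remaining : List (Vec Bool m)
      unique    : Unique remaining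
      pending   : Pending (C ++ₗ circuit) remaining
      fewer     : length remaining + k ≡ length U

  -- Positions fill one face of the cube and goals the opposite one, so flipping the first
  -- coordinate solves all picked inputs at once. An unpicked input sitting on one of these goals is
  -- displaced, which is harmless since it stays pending.
  advance : ∀ C U → Unique U → Pending C U → (∀ {a} → a ∈ U → run C a ≢ goal a) → 5 * k ≤ length U → Advanced C U
  advance C U u pending unsolved le = fromPick (pick (run C) goal (run (reverse C)) (act (reverse w₀))
      (run-reverse C) (act-reverse w₀) (suc l) [] U u le)
    where
    fromPick : Picked (run C) goal (run (reverse C)) (act (reverse w₀)) (run-reverse C) (act-reverse w₀) (suc l) [] U →
               Advanced C U
    fromPick picked = fromGroup (group 4+l≤m P (λ {c} {d} → injective {c} {d}))
      where
      module Q = Picked picked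
      P : Vec Bool (2 + l) → Vec Bool m
      P (false ∷ c) = run C (Q.point c)
      P (true  ∷ c) = goal (Q.point c)
      clash : ∀ {c d} → run C (Q.point c) ≢ goal (Q.point d)
      clash {c} {d} with c ≟ᵥ d
      ... | yes refl = unsolved (Q.point∈ c)
      ... | no c≢d   = Q.apart c≢d
      injective : ∀ {c d} → P c ≡ P d → c ≡ d
      injective {false ∷ c} {false ∷ d} eq = cong (false ∷_) (Q.injective (run-injective C eq))
      injective {true  ∷ c} {true  ∷ d} eq = cong (true ∷_) (Q.injective (act-injective w₀ eq))
      injective {false ∷ c} {true  ∷ d} eq = ⊥-elim (clash eq)
      injective {true  ∷ c} {false ∷ d} eq = ⊥-elim (clash (sym eq))
      fromGroup : Grouped P → Advanced C U
      fromGroup grouped = record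
        { circuit = T.circuit ; size = T.size ; remaining = Q.remaining ; unique = Q.unique
        ; pending = pending′ ; fewer = Q.size }
        where
        module T = Grouped grouped
        -- A solved input sits at its goal; by injectivity it meets the group only if it is itself a
        -- picked, hence unsolved, input.
        solved-outside : ∀ {a} → run C a ≡ goal a → ∀ c → goal a ≢ P c
        solved-outside e (false ∷ c) eq with refl ← run-injective C (trans e eq) = unsolved (Q.point∈ c) e
        solved-outside e (true  ∷ c) eq with refl ← act-injective w₀ eq         = unsolved (Q.point∈ c) e
        pending′ : Pending (C ++ₗ T.circuit) Q.remaining
        pending′ {a} a∈ with pending a∈
        ... | inj₂ e = inj₂ (trans (run-++ C T.circuit a) (trans (cong (run T.circuit) e) (T.fixes (solved-outside e))))
        ... | inj₁ a∈U with Q.cover a∈U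
        ...   | inj₁ a∈R      = inj₁ a∈R
        ...   | inj₂ (c , refl) = inj₂ (trans (run-++ C T.circuit a) (T.swaps false c))

  -- The size is multiplied by `k` to avoid division: a group of cost `G` removes `k` inputs, so
  -- each input is charged `G`. The last term pays for fewer than `5 * k` leftover inputs. Inputs
  -- that got solved by accident are filtered out first, since a group needs unsolved ones.
  complete : ∀ fuel C U → length U < fuel → Unique U → Pending C U →
             Completion C λ s → s * k ≤ length U * G + k * (5 * k * G₂)
  complete (suc fuel) C U (s≤s lt) u pending = decide (5 * k ℕ.≤? length V)
    where
    V : List (Vec Bool m)
    V = filter (λ a → ¬? (run C a ≟ᵥ goal a)) U
    V≤U : length V ≤ length U
    V≤U = L.length-filter (λ a → ¬? (run C a ≟ᵥ goal a)) U
    uV : Unique V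
    uV = U.filter⁺ (λ a → ¬? (run C a ≟ᵥ goal a)) u
    unsolved : ∀ {a} → a ∈ V → run C a ≢ goal a
    unsolved a∈ = proj₂ (M.∈-filter⁻ (λ a → ¬? (run C a ≟ᵥ goal a)) {xs = U} a∈)
    pendingV : Pending C V
    pendingV {a} a∈ with pending a∈ | run C a ≟ᵥ goal a
    ... | inj₂ e   | _     = inj₂ e
    ... | inj₁ _   | yes e = inj₂ e
    ... | inj₁ a∈U | no ¬e = inj₁ (M.∈-filter⁺ (λ a → ¬? (run C a ≟ᵥ goal a)) a∈U ¬e)
    Result : Set
    Result = Completion C λ s → s * k ≤ length U * G + k * (5 * k * G₂)
    open ℕₚ.≤-Reasoning
    fromFinish : length V < 5 * k → (Completion C λ s → s ≤ suc (length V) * G₂) → Result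
    fromFinish few (T , runs , size) = T , runs , (begin
      length T * k                         ≤⟨ ℕₚ.*-monoˡ-≤ k (ℕₚ.≤-trans size (ℕₚ.*-monoˡ-≤ G₂ few)) ⟩
      5 * k * G₂ * k                       ≡⟨ ℕₚ.*-comm (5 * k * G₂) k ⟩
      k * (5 * k * G₂)                     ≤⟨ ℕₚ.m≤n+m _ (length U * G) ⟩
      length U * G + k * (5 * k * G₂) ∎)
    fromAdvance : Advanced C V → Result
    fromAdvance advanced = next (complete fuel (C ++ₗ A.circuit) A.remaining shrinks A.unique A.pending)
      where
      module A = Advanced advanced
      shrinks : length A.remaining < fuel
      shrinks = begin-strict
        length A.remaining         <⟨ ℕₚ.m<m+n _ (ℕₚ.m^n>0 2 (suc l)) ⟩
        length A.remaining + k     ≡⟨ A.fewer ⟩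
        length V                   ≤⟨ ℕₚ.≤-trans V≤U lt ⟩
        fuel ∎
      next : (Completion (C ++ₗ A.circuit) λ s → s * k ≤ length A.remaining * G + k * (5 * k * G₂)) → Result
      next (T , runs , size) = A.circuit ++ₗ T ,
        (λ {a} a∈ → trans (run-++ A.circuit T (run C a))
          (trans (cong (run T) (sym (run-++ C A.circuit a))) (runs a∈))) ,
        (begin
          length (A.circuit ++ₗ T) * k                                     ≡⟨ cong (_* k) (L.length-++ A.circuit) ⟩
          (length A.circuit + length T) * k                                ≡⟨ ℕₚ.*-distribʳ-+ k (length A.circuit) (length T) ⟩
          length A.circuit * k + length T * k                              ≤⟨ ℕₚ.+-mono-≤ (ℕₚ.*-monoˡ-≤ k A.size) size ⟩
          G * k + (length A.remaining * G + k * (5 * k * G₂))              ≡⟨ regroup G k (length A.remaining) (k * (5 * k * G₂)) ⟩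
          (length A.remaining + k) * G + k * (5 * k * G₂)                  ≡⟨ cong (λ a → a * G + k * (5 * k * G₂)) A.fewer ⟩
          length V * G + k * (5 * k * G₂)                                  ≤⟨ ℕₚ.+-monoˡ-≤ _ (ℕₚ.*-monoˡ-≤ G V≤U) ⟩
          length U * G + k * (5 * k * G₂) ∎)
        where
        regroup : ∀ g κ r z → g * κ + (r * g + z) ≡ (r + κ) * g + z
        regroup = solve-∀
    decide : Dec (5 * k ≤ length V) → Result
    decide (yes le) = fromAdvance (advance C V uV pendingV unsolved le)
    decide (no ¬le) = fromFinish (ℕₚ.≰⇒> ¬le) (finish C V pendingV)

  synthesize : Unique A → Completion [] λ s → s * k ≤ length A * G + k * (5 * k * G₂)
  synthesize u = complete (suc (length A)) [] A ℕₚ.≤-refl u inj₁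

-- Changing the number of additional inputs

module _ {m M : ℕ} (ι : Fin m → Fin M) (ι-injective : ∀ {i j} → ι i ≡ ι j → i ≡ j) where

  restrict : Vec Bool M → Vec Bool m
  restrict y = tabulate (lookup y ∘ ι)

  lookup-restrict : ∀ y i → lookup (restrict y) i ≡ lookup y (ι i)
  lookup-restrict y i = V.lookup∘tabulate (lookup y ∘ ι) i

  liftGate : Gate m → Gate M
  liftGate g = gate (map ι (Gate.controls g)) (ι (Gate.target g)) (U.map⁺ ι-injective (Gate.distinct g)) free
    (ℕₚ.≤-trans (ℕₚ.≤-reflexive (L.length-map ι (Gate.controls g))) (Gate.atMostTwo g))
    where
    free : ι (Gate.target g) ∉ map ι (Gate.controls g)
    free t∈ with M.∈-map⁻ ι t∈
    ... | c , c∈ , eq = Gate.targetFree g (subst (_∈ Gate.controls g) (ι-injective (sym eq)) c∈)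

  conj-restrict : ∀ y cs → conj y (map ι cs) ≡ conj (restrict y) cs
  conj-restrict y []       = refl
  conj-restrict y (c ∷ cs) = cong₂ _∧_ (sym (lookup-restrict y c)) (conj-restrict y cs)

  restrict-applyGate : ∀ g y → restrict (applyGate (liftGate g) y) ≡ applyGate g (restrict y)
  restrict-applyGate g y = lookup-ext at
    where
    t = Gate.target g
    δ = conj y (map ι (Gate.controls g))
    at : ∀ i → lookup (restrict (applyGate (liftGate g) y)) i ≡ lookup (applyGate g (restrict y)) i
    at i with i F.≟ t
    ... | yes refl = trans (lookup-restrict (applyGate (liftGate g) y) t) (trans (lookup-add (ι t) δ y)
          (trans (cong₂ _xor_ (sym (lookup-restrict y t)) (conj-restrict y (Gate.controls g)))
            (sym (lookup-add t (conj (restrict y) (Gate.controls g)) (restrict y)))))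
    ... | no i≢t = trans (lookup-restrict (applyGate (liftGate g) y) i) (trans (lookup-add-≢ y (i≢t ∘ ι-injective))
          (trans (sym (lookup-restrict y i)) (sym (lookup-add-≢ (restrict y) i≢t))))

  restrict-run : ∀ C y → restrict (run (map liftGate C) y) ≡ run C (restrict y)
  restrict-run []      y = refl
  restrict-run (g ∷ C) y = trans (restrict-run C (applyGate (liftGate g) y)) (cong (run C) (restrict-applyGate g y))

take-pad : ∀ {l} m (c : Vec Bool l) → take l (pad m c) ≡ c
take-pad {l} m c = lookup-ext λ i → trans (lookup-take (pad m c) i) (lookup-pad-↑ˡ c i)

implements-mono : ∀ {n p q f} → p ≤ q → (C : Circuit (n + p)) → Implements n p C f →
                  Σ (Circuit (n + q)) λ D → Implements n q D f × length D ≡ length C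
implements-mono {n} {p} {q} {f} p≤q C implements = map lifted C , computes , L.length-map lifted C
  where
  ι : Fin (n + p) → Fin (n + q)
  ι i = Data.Fin.inject≤ i (ℕₚ.+-monoʳ-≤ n p≤q)
  ι-injective : ∀ {i j} → ι i ≡ ι j → i ≡ j
  ι-injective {i} {j} eq = F.toℕ-injective (trans (sym (F.toℕ-inject≤ i _)) (trans (cong toℕ eq) (F.toℕ-inject≤ j _)))
  lifted : Gate (n + p) → Gate (n + q)
  lifted = liftGate ι ι-injective
  ι-↑ˡ : ∀ i → ι (i ↑ˡ p) ≡ i ↑ˡ q
  ι-↑ˡ i = F.toℕ-injective (trans (F.toℕ-inject≤ (i ↑ˡ p) _) (trans (F.toℕ-↑ˡ i p) (sym (F.toℕ-↑ˡ i q))))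
  ι-↑ʳ : ∀ j → ι (n ↑ʳ j) ≡ n ↑ʳ Data.Fin.inject≤ j p≤q
  ι-↑ʳ j = F.toℕ-injective (trans (F.toℕ-inject≤ (n ↑ʳ j) _) (trans (F.toℕ-↑ʳ n j)
    (trans (cong (n +_) (sym (F.toℕ-inject≤ j p≤q))) (sym (F.toℕ-↑ʳ n (Data.Fin.inject≤ j p≤q))))))
  restricted : ∀ x → restrict ι ι-injective (pad q x) ≡ pad p x
  restricted x = lookup-ext at
    where
    at : ∀ i → lookup (restrict ι ι-injective (pad q x)) i ≡ lookup (pad p x) i
    at i with line n p i
    ... | inCube k = trans (lookup-restrict ι ι-injective (pad q x) (k ↑ˡ p))
          (trans (cong (lookup (pad q x)) (ι-↑ˡ k)) (trans (lookup-pad-↑ˡ x k) (sym (lookup-pad-↑ˡ x k))))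
    ... | inRest j = trans (lookup-restrict ι ι-injective (pad q x) (n ↑ʳ j))
          (trans (cong (lookup (pad q x)) (ι-↑ʳ j))
            (trans (lookup-pad-↑ʳ x (Data.Fin.inject≤ j p≤q)) (sym (lookup-pad-↑ʳ x j))))
  take-restrict : ∀ y → take n y ≡ take n (restrict ι ι-injective y)
  take-restrict y = lookup-ext λ i → trans (lookup-take y i) (sym (trans (lookup-take (restrict ι ι-injective y) i)
    (trans (lookup-restrict ι ι-injective y (i ↑ˡ p)) (cong (lookup y) (ι-↑ˡ i)))))
  computes : Implements n q (map lifted C) f
  computes x = trans (take-restrict (run (map lifted C) (pad q x)))
    (trans (cong (take n) (trans (restrict-run ι ι-injective C (pad q x)) (cong (run C) (restricted x)))) (implements x))

xor-cancelʳ : ∀ a b c → a xor c ≡ b xor c → a ≡ b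
xor-cancelʳ a b c eq = trans (sym (undo a)) (trans (cong (_xor c) eq) (undo b))
  where
  undo : ∀ a → (a xor c) xor c ≡ a
  undo a = trans (B.xor-assoc a c c) (trans (cong (a xor_) (B.xor-same c)) (B.xor-identityʳ a))

replicate-≢ : ∀ {n} → 1 ≤ n → replicate n false ≢ replicate n true
replicate-≢ (s≤s _) ()

-- The map (x , y) ↦ (y xor f x , x) is bijective and computes f from y = 0; the parity of its word
-- is adjusted on two points with y ≠ 0.
module _ {n : ℕ} (1≤n : 1 ≤ n) (f : Vec Bool n → Vec Bool n) where
  private
    π : Vec Bool (n + n) → Vec Bool (n + n)
    π z = zipWith _xor_ (drop n z) (f (take n z)) ++ᵥ take n z

    π-injective : ∀ {y z} → π y ≡ π z → y ≡ z
    π-injective {y} {z} eq = trans (sym (V.take++drop≡id n y)) (trans (cong₂ _++ᵥ_ takes drops) (V.take++drop≡id n z))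
      where
      xors : zipWith _xor_ (drop n y) (f (take n y)) ≡ zipWith _xor_ (drop n z) (f (take n z))
      xors = V.++-injectiveˡ _ _ eq
      takes : take n y ≡ take n z
      takes = V.++-injectiveʳ (zipWith _xor_ (drop n y) (f (take n y))) _ eq
      drops : drop n y ≡ drop n z
      drops = lookup-ext λ i → xor-cancelʳ _ _ (lookup (f (take n z)) i) (begin
        lookup (drop n y) i xor lookup (f (take n z)) i   ≡⟨ cong (λ x → lookup (drop n y) i xor lookup (f x) i) takes ⟨
        lookup (drop n y) i xor lookup (f (take n y)) i   ≡⟨ V.lookup-zipWith _xor_ i (drop n y) (f (take n y)) ⟨
        lookup (zipWith _xor_ (drop n y) (f (take n y))) i ≡⟨ cong (λ x → lookup x i) xors ⟩
        lookup (zipWith _xor_ (drop n z) (f (take n z))) i ≡⟨ V.lookup-zipWith _xor_ i (drop n z) (f (take n z)) ⟩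
        lookup (drop n z) i xor lookup (f (take n z)) i ∎)
        where open ≡-Reasoning

    π-computes : ∀ x → take n (π (pad n x)) ≡ f x
    π-computes x = lookup-ext λ i → begin
      lookup (take n (π (pad n x))) i
        ≡⟨ lookup-take (π (pad n x)) i ⟩
      lookup (π (pad n x)) (i ↑ˡ n)
        ≡⟨ V.lookup-++ˡ (zipWith _xor_ (drop n (pad n x)) (f (take n (pad n x)))) (take n (pad n x)) i ⟩
      lookup (zipWith _xor_ (drop n (pad n x)) (f (take n (pad n x)))) i
        ≡⟨ V.lookup-zipWith _xor_ i (drop n (pad n x)) (f (take n (pad n x))) ⟩
      lookup (drop n (pad n x)) i xor lookup (f (take n (pad n x))) i
        ≡⟨ cong₂ (λ y z → lookup y i xor lookup (f z) i) drop-pad (take-pad n x) ⟩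
      lookup (replicate n false) i xor lookup (f x) i
        ≡⟨ cong (_xor lookup (f x) i) (V.lookup-replicate i false) ⟩
      lookup (f x) i ∎
      where
      open ≡-Reasoning
      drop-pad : drop n (pad n x) ≡ replicate n false
      drop-pad = V.++-injectiveʳ (take n (pad n x)) x (V.take++drop≡id n (pad n x))

    d d′ : Vec Bool (n + n)
    d  = replicate n false ++ᵥ replicate n true
    d′ = replicate n true ++ᵥ replicate n true

    irrelevant : ∀ {c x : Vec Bool n} → pad n x ≢ c ++ᵥ replicate n true
    irrelevant {c} {x} eq = replicate-≢ 1≤n (V.++-injectiveʳ x c eq)

  universalWord : ∃ λ w → Proper w × odd w ≡ false × (∀ x → take n (act w (pad n x)) ≡ f x)
  universalWord = repair (word π π-injective)
    where
    repair : (∃ λ w → Proper w × act w ≗ π) → ∃ λ w → Proper w × odd w ≡ false × (∀ x → take n (act w (pad n x)) ≡ f x)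
    repair (w , proper , acts) with odd w in eq
    ... | false = w , proper , eq , λ x → trans (cong (take n) (acts (pad n x))) (π-computes x)
    ... | true  = w ++ₗ (d , d′) ∷ [] , Allₚ.++⁺ proper ((replicate-≢ 1≤n ∘ V.++-injectiveˡ _ _ , (λ ()) , (λ ())) ∷ []) ,
          trans (odd-++ w ((d , d′) ∷ [])) (cong (_xor true) eq) ,
          λ x → trans (cong (take n) (trans (act-++ w ((d , d′) ∷ []) (pad n x))
                  (trans (cong (act w) (swap-other (irrelevant {replicate n false}) (irrelevant {replicate n true})))
                         (acts (pad n x))))) (π-computes x)

synthesizeImplementation : ∀ {n p l f} → 4 + l ≤ n + p → (w : Word (n + p)) → Proper w → odd w ≡ false →
  (∀ x → take n (act w (pad p x)) ≡ f x) →
  Σ (Circuit (n + p)) λ C → Implements n p C f ×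
    length C * 2 ^ suc l ≤ 2 ^ n * groupCost (2 + l) (n + p) + 2 ^ suc l * (5 * 2 ^ suc l * groupCost 2 (n + p))
synthesizeImplementation {n} {p} {l} {f} le w proper even computes =
  done (synthesize le (map (pad p) (allVecs n)) w proper even (U.map⁺ pad-injective (allVecs-unique n)))
  where
  A : List (Vec Bool (n + p))
  A = map (pad p) (allVecs n)
  rest : ℕ
  rest = 2 ^ suc l * (5 * 2 ^ suc l * groupCost 2 (n + p))
  done : (Σ (Circuit (n + p)) λ T → (∀ {a} → a ∈ A → run T a ≡ act w a) ×
            length T * 2 ^ suc l ≤ length A * groupCost (2 + l) (n + p) + rest) →
         Σ (Circuit (n + p)) λ C → Implements n p C f ×
           length C * 2 ^ suc l ≤ 2 ^ n * groupCost (2 + l) (n + p) + rest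
  done (T , runs , size) = T ,
    (λ x → trans (cong (take n) (runs (M.∈-map⁺ (pad p) (∈-allVecs x)))) (computes x)) ,
    subst (λ a → length T * 2 ^ suc l ≤ a * groupCost (2 + l) (n + p) + rest)
      (trans (L.length-map (pad p) (allVecs n)) (length-allVecs n)) size

-- Arithmetic

n<2^n : ∀ n → n < 2 ^ n
n<2^n zero    = s≤s z≤n
n<2^n (suc n) = ℕₚ.+-mono-≤ (ℕₚ.m^n>0 2 n) (ℕₚ.≤-trans (n<2^n n) (ℕₚ.≤-reflexive (sym (ℕₚ.+-identityʳ (2 ^ n)))))

2^⌊log₂n⌋≤n : ∀ n → 1 ≤ n → 2 ^ ⌊log₂ n ⌋ ≤ n
2^⌊log₂n⌋≤n n = go n (<-wellFounded n)
  where
  open ℕₚ.≤-Reasoning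
  go : ∀ n → Acc _<_ n → 1 ≤ n → 2 ^ ⌊log₂ n ⌋ ≤ n
  go (suc zero)      _         _ = ℕₚ.≤-reflexive (cong (2 ^_) (⌊log₂[2^n]⌋≡n 0))
  go n@(suc (suc h)) (acc rec) _ = begin
    2 ^ ⌊log₂ n ⌋                    ≤⟨ ℕₚ.^-monoʳ-≤ 2 (ℕₚ.m≤n+m∸n ⌊log₂ n ⌋ 1) ⟩
    2 * 2 ^ (⌊log₂ n ⌋ ∸ 1)          ≡⟨ cong (λ a → 2 * 2 ^ a) (⌊log₂⌊n/2⌋⌋≡⌊log₂n⌋∸1 n) ⟨
    2 * 2 ^ ⌊log₂ ⌊ n /2⌋ ⌋          ≤⟨ ℕₚ.*-monoʳ-≤ 2 (go ⌊ n /2⌋ (rec (ℕₚ.⌊n/2⌋<n (suc h))) (s≤s z≤n)) ⟩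
    2 * ⌊ n /2⌋                      ≡⟨ cong (⌊ n /2⌋ +_) (ℕₚ.+-identityʳ ⌊ n /2⌋) ⟩
    ⌊ n /2⌋ + ⌊ n /2⌋                ≤⟨ ℕₚ.+-monoʳ-≤ ⌊ n /2⌋ (ℕₚ.⌊n/2⌋≤⌈n/2⌉ n) ⟩
    ⌊ n /2⌋ + ⌈ n /2⌉                ≡⟨ ℕₚ.⌊n/2⌋+⌈n/2⌉≡n n ⟩
    n ∎

-- With `x = 2 ^ k` this turns the error term `16 * k * (x * x)` of a group into at most
-- `x * (x * x)`.
16*k≤2^k : ∀ k → 7 ≤ k → 16 * k ≤ 2 ^ k
16*k≤2^k k 7≤k with ℕₚ.m≤n⇒∃[o]m+o≡n 7≤k
... | j , refl = go j
  where
  open ℕₚ.≤-Reasoning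
  step : ∀ a → 16 * (7 + suc a) ≡ 16 + 16 * (7 + a)
  step = solve-∀
  go : ∀ j → 16 * (7 + j) ≤ 2 ^ (7 + j)
  go zero    = ℕₚ.≤ᵇ⇒≤ 112 128 _
  go (suc j) = begin
    16 * (7 + suc j)            ≡⟨ step j ⟩
    16 + 16 * (7 + j)           ≤⟨ ℕₚ.+-monoˡ-≤ (16 * (7 + j)) (ℕₚ.*-monoʳ-≤ 16 (s≤s (z≤n {6 + j}))) ⟩
    16 * (7 + j) + 16 * (7 + j) ≤⟨ ℕₚ.+-mono-≤ (go j) (go j) ⟩
    2 ^ (7 + j) + 2 ^ (7 + j)   ≡⟨ cong (2 ^ (7 + j) +_) (ℕₚ.+-identityʳ (2 ^ (7 + j))) ⟨
    2 ^ (7 + suc j) ∎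

-- Used with `L` the logarithm of `n` and `k = 2 ^ e`: the lower bound gives `2 ^ (3 * k) ≤ n`, and
-- the upper one says that rounding to a power of two leaves `L < 6 * k`.
powerBelow : ∀ L → 3 ≤ L → ∃ λ e → 3 * 2 ^ e ≤ L × L < 3 * 2 ^ suc e
powerBelow L 3≤L with ℕₚ.m≤n⇒∃[o]m+o≡n 3≤L
... | j , refl = go j
  where
  go : ∀ j → ∃ λ e → 3 * 2 ^ e ≤ 3 + j × 3 + j < 3 * 2 ^ suc e
  go zero = 0 , ℕₚ.≤-refl , ℕₚ.≤ᵇ⇒≤ 4 6 _
  go (suc j) with go j
  ... | e , lo , hi with 3 + suc j ℕ.<? 3 * 2 ^ suc e
  ...   | yes hi′ = e , ℕₚ.≤-trans lo (s≤s (s≤s (s≤s (ℕₚ.n≤1+n j)))) , hi′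
  ...   | no ≥    = suc e , ℕₚ.≮⇒≥ ≥ , ℕₚ.<-≤-trans (s≤s hi) bound
    where
    open ℕₚ.≤-Reasoning
    double : ∀ a → 3 * a + 3 * a ≡ 3 * (2 * a)
    double = solve-∀
    bound : suc (3 * 2 ^ suc e) ≤ 3 * 2 ^ suc (suc e)
    bound = begin
      1 + 3 * 2 ^ suc e              ≤⟨ ℕₚ.+-monoˡ-≤ (3 * 2 ^ suc e) (ℕₚ.*-mono-≤ {1} {3} (s≤s z≤n) (ℕₚ.m^n>0 2 (suc e))) ⟩
      3 * 2 ^ suc e + 3 * 2 ^ suc e  ≡⟨ double (2 ^ suc e) ⟩
      3 * 2 ^ suc (suc e) ∎

groupCost-unfold : ∀ l m → groupCost l m ≡ 12 * m + (2 * (2 ^ l * (21 * l + 25 + 2 ^ 2 ^ l)) + 12)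
groupCost-unfold l m = expand l m (2 ^ l) (2 ^ 2 ^ l)
  where
  expand : ∀ l m s z → (m + s * ((l + suc z) + 2 * (10 * l + 12))) + ((10 * m + 12) + (m + s * ((l + suc z) + 2 * (10 * l + 12))))
           ≡ 12 * m + (2 * (s * (21 * l + 25 + z)) + 12)
  expand = solve-∀

-- With x = 2 ^ k and 2 ^ l = 2 k, the terms besides 12 m are of order k x ^ 2.
groupCost-bound : ∀ {l k m} → 2 ^ l ≡ 2 * k → 7 ≤ k → 2 ^ k * (2 ^ k * 2 ^ k) ≤ m → groupCost l m ≤ 13 * m
groupCost-bound {l} {k} {m} 2^l≡ 7≤k xxx≤m = begin
  groupCost l m                                                  ≡⟨ groupCost-unfold l m ⟩
  12 * m + (2 * (2 ^ l * (21 * l + 25 + 2 ^ 2 ^ l)) + 12)        ≡⟨ cong (λ s → 12 * m + (2 * (s * (21 * l + 25 + 2 ^ s)) + 12)) 2^l≡ ⟩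
  12 * m + (2 * (2 * k * (21 * l + 25 + 2 ^ (2 * k))) + 12)      ≡⟨ cong (λ z → 12 * m + (2 * (2 * k * (21 * l + 25 + z)) + 12)) square ⟩
  12 * m + (2 * (2 * k * (21 * l + 25 + x * x)) + 12)            ≤⟨ ℕₚ.+-monoʳ-≤ (12 * m) (ℕₚ.+-mono-≤
                                                                      (ℕₚ.*-monoʳ-≤ 2 (ℕₚ.*-monoʳ-≤ (2 * k) (ℕₚ.+-monoˡ-≤ (x * x) small))) twelve) ⟩
  12 * m + (2 * (2 * k * (x * x + x * x)) + 8 * k * (x * x))     ≡⟨ collect m k (x * x) ⟩
  12 * m + 16 * k * (x * x)                                      ≤⟨ ℕₚ.+-monoʳ-≤ (12 * m) (ℕₚ.*-monoˡ-≤ (x * x) 16k≤x) ⟩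
  12 * m + x * (x * x)                                           ≤⟨ ℕₚ.+-monoʳ-≤ (12 * m) xxx≤m ⟩
  12 * m + m                                                     ≡⟨ ℕₚ.+-comm (12 * m) m ⟩
  13 * m ∎
  where
  open ℕₚ.≤-Reasoning
  x : ℕ
  x = 2 ^ k
  16k≤x : 16 * k ≤ x
  16k≤x = 16*k≤2^k k 7≤k
  1≤k : 1 ≤ k
  1≤k = ℕₚ.≤-trans (s≤s z≤n) 7≤k
  l≤2k : l ≤ 2 * k
  l≤2k = ℕₚ.≤-trans (ℕₚ.<⇒≤ (n<2^n l)) (ℕₚ.≤-reflexive 2^l≡)
  square : 2 ^ (2 * k) ≡ x * x
  square = trans (cong (λ a → 2 ^ (k + a)) (ℕₚ.+-identityʳ k)) (ℕₚ.^-distribˡ-+-* 2 k k)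
  collect : ∀ m k y → 12 * m + (2 * (2 * k * (y + y)) + 8 * k * y) ≡ 12 * m + 16 * k * y
  collect = solve-∀
  k≤x : k ≤ x
  k≤x = ℕₚ.≤-trans (ℕₚ.m≤m+n k _) 16k≤x
  small : 21 * l + 25 ≤ x * x
  small = begin
    21 * l + 25           ≤⟨ ℕₚ.+-mono-≤ (ℕₚ.*-monoʳ-≤ 21 l≤2k) (ℕₚ.*-monoʳ-≤ 25 1≤k) ⟩
    21 * (2 * k) + 25 * k ≤⟨ ℕₚ.m≤m+n _ (45 * k) ⟩
    21 * (2 * k) + 25 * k + 45 * k ≡⟨ total k ⟩
    7 * (16 * k)          ≤⟨ ℕₚ.*-mono-≤ (ℕₚ.≤-trans 7≤k k≤x) 16k≤x ⟩
    x * x ∎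
    where
    total : ∀ k → 21 * (2 * k) + 25 * k + 45 * k ≡ 7 * (16 * k)
    total = solve-∀
  twelve : 12 ≤ 8 * k * (x * x)
  twelve = ℕₚ.≤-trans (ℕₚ.≤ᵇ⇒≤ 12 56 _) (ℕₚ.*-mono-≤ {56} {8 * k} {1} {x * x} (ℕₚ.*-monoʳ-≤ 8 7≤k)
             (ℕₚ.*-mono-≤ (ℕₚ.m^n>0 2 k) (ℕₚ.m^n>0 2 k)))

-- Groups consist of `k = 2 ^ suc l` transpositions, and their `2 * k` points fill a cube of
-- dimension `2 + l`. In `room`, two of the three factors `2 ^ k` count the possible columns and the
-- third absorbs the factor `16 * k`.
record Scale (n : ℕ) : Set where
  field
    l      : ℕ
    7≤k    : 7 ≤ 2 ^ suc l
    room   : 2 ^ 2 ^ suc l * (2 ^ 2 ^ suc l * 2 ^ 2 ^ suc l) ≤ n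
    log<6k : ⌊log₂ n ⌋ ≤ 6 * 2 ^ suc l

-- From `48 ≤ 6 * k` it follows that `8 ≤ k`. The exponent 0 is excluded because it would make the
-- logarithm less than 6.
scale : ∀ L n → 48 ≤ L → 2 ^ L ≤ n → Scale n
scale L n 48≤L 2^L≤n = choose (powerBelow ⌊log₂ n ⌋ (ℕₚ.≤-trans (ℕₚ.≤ᵇ⇒≤ 3 48 _) 48≤log))
  where
  open ℕₚ.≤-Reasoning
  48≤log : 48 ≤ ⌊log₂ n ⌋
  48≤log = ℕₚ.≤-trans 48≤L (ℕₚ.≤-trans (ℕₚ.≤-reflexive (sym (⌊log₂[2^n]⌋≡n L))) (⌊log₂⌋-mono-≤ 2^L≤n))
  cube : ∀ k → 2 ^ (3 * k) ≡ 2 ^ k * (2 ^ k * 2 ^ k)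
  cube k = trans (cong (λ a → 2 ^ (k + (k + a))) (ℕₚ.+-identityʳ k))
    (trans (ℕₚ.^-distribˡ-+-* 2 k (k + k)) (cong (2 ^ k *_) (ℕₚ.^-distribˡ-+-* 2 k k)))
  six : ∀ k → 3 * (2 * k) ≡ 6 * k
  six = solve-∀
  choose : (∃ λ e → 3 * 2 ^ e ≤ ⌊log₂ n ⌋ × ⌊log₂ n ⌋ < 3 * 2 ^ suc e) → Scale n
  choose (zero , lo , hi) = ⊥-elim (ℕₚ.<⇒≱ hi (ℕₚ.≤-trans (ℕₚ.≤ᵇ⇒≤ 6 48 _) 48≤log))
  choose (suc l , lo , hi) = record
    { l = l
    ; 7≤k = ℕₚ.<⇒≤ (ℕₚ.*-cancelˡ-≤ 6 (ℕₚ.≤-trans 48≤log log≤))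
    ; room = begin
        2 ^ k * (2 ^ k * 2 ^ k)   ≡⟨ cube k ⟨
        2 ^ (3 * k)               ≤⟨ ℕₚ.^-monoʳ-≤ 2 lo ⟩
        2 ^ ⌊log₂ n ⌋             ≤⟨ 2^⌊log₂n⌋≤n n (ℕₚ.≤-trans (ℕₚ.m^n>0 2 L) 2^L≤n) ⟩
        n ∎
    ; log<6k = log≤ }
    where
    k : ℕ
    k = 2 ^ suc l
    log≤ : ⌊log₂ n ⌋ ≤ 6 * k
    log≤ = ℕₚ.≤-trans (ℕₚ.<⇒≤ hi) (ℕₚ.≤-reflexive (six k))

module _ {n : ℕ} (S : Scale n) where
  open Scale S
  private
    k x : ℕ
    k = 2 ^ suc l
    x = 2 ^ k

    x³≤n : x * (x * x) ≤ n
    x³≤n = room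

    16k≤x : 16 * k ≤ x
    16k≤x = 16*k≤2^k k 7≤k

    x≥1 : 1 ≤ x
    x≥1 = ℕₚ.m^n>0 2 k

    x≤n : x ≤ n
    x≤n = ℕₚ.≤-trans (ℕₚ.≤-reflexive (sym (ℕₚ.*-identityʳ x)))
            (ℕₚ.≤-trans (ℕₚ.*-monoʳ-≤ x (ℕₚ.*-mono-≤ x≥1 x≥1)) x³≤n)

  4+l≤n : 4 + l ≤ n
  4+l≤n = begin
    4 + l       ≤⟨ ℕₚ.+-mono-≤ (ℕₚ.≤-trans (ℕₚ.≤ᵇ⇒≤ 4 7 _) 7≤k) (ℕₚ.≤-trans (ℕₚ.n≤1+n l) (ℕₚ.<⇒≤ (n<2^n (suc l)))) ⟩
    k + k       ≤⟨ ℕₚ.m≤m+n (k + k) (14 * k) ⟩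
    k + k + 14 * k ≡⟨ total k ⟩
    16 * k      ≤⟨ ℕₚ.≤-trans 16k≤x x≤n ⟩
    n ∎
    where
    open ℕₚ.≤-Reasoning
    total : ∀ k → k + k + 14 * k ≡ 16 * k
    total = solve-∀

  module _ {p : ℕ} (p≤n : p ≤ n) where
    private
      m : ℕ
      m = n + p

      n≤m : n ≤ m
      n≤m = ℕₚ.m≤m+n n p

      cost : groupCost (2 + l) m ≤ 13 * m
      cost = groupCost-bound {2 + l} {k} refl 7≤k (ℕₚ.≤-trans x³≤n n≤m)

      cost₂ : groupCost 2 m ≤ 13 * m
      cost₂ = ℕₚ.≤-trans (ℕₚ.≤-reflexive (groupCost-unfold 2 m))
        (ℕₚ.≤-trans (ℕₚ.+-monoʳ-≤ (12 * m) (ℕₚ.≤-trans 676≤n n≤m)) (ℕₚ.≤-reflexive (ℕₚ.+-comm (12 * m) m)))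
        where
        -- Besides `12 * m`, `groupCost 2 m` consists of `2 * (4 * (42 + 25 + 16)) + 12 = 676`; and
        -- `112 = 16 * 7` is at most `x`.
        676≤n : 676 ≤ n
        676≤n = ℕₚ.≤-trans (ℕₚ.≤ᵇ⇒≤ 676 (112 * 112) _)
          (ℕₚ.≤-trans (ℕₚ.*-mono-≤ (ℕₚ.≤-trans (ℕₚ.*-monoʳ-≤ 16 7≤k) 16k≤x) (ℕₚ.≤-trans (ℕₚ.*-monoʳ-≤ 16 7≤k) 16k≤x))
            (ℕₚ.≤-trans (ℕₚ.≤-reflexive (sym (ℕₚ.*-identityˡ (x * x)))) (ℕₚ.≤-trans (ℕₚ.*-monoˡ-≤ (x * x) x≥1) x³≤n)))

      -- The leftover inputs contribute this much per line to the bound multiplied by `k`;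
      -- `65 + 191 = 16 * 16` compares it with `x * x`. The factor 3 is the room between 13 and 16.
      tail : 13 * (5 * (k * k)) ≤ 3 * 2 ^ n
      tail = begin
        13 * (5 * (k * k))              ≤⟨ ℕₚ.m≤m+n _ (191 * (k * k)) ⟩
        13 * (5 * (k * k)) + 191 * (k * k) ≡⟨ total k ⟩
        1 * (16 * k * (16 * k))         ≤⟨ ℕₚ.*-mono-≤ x≥1 (ℕₚ.*-mono-≤ 16k≤x 16k≤x) ⟩
        x * (x * x)                     ≤⟨ x³≤n ⟩
        n                               ≤⟨ ℕₚ.<⇒≤ (n<2^n n) ⟩
        2 ^ n                           ≤⟨ ℕₚ.m≤m+n (2 ^ n) _ ⟩
        3 * 2 ^ n ∎
        where
        open ℕₚ.≤-Reasoning
        total : ∀ k → 13 * (5 * (k * k)) + 191 * (k * k) ≡ 1 * (16 * k * (16 * k))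
        total = solve-∀

    -- `192 = 6 * 16 * 2`: the 6 comes from the logarithm being at most `6 * k`, `16 = 13 + 3` from
    -- the groups and the leftover inputs, and the 2 from `m ≤ 2 * n`.
    sizeBound : ∀ {s} → s * k ≤ 2 ^ n * groupCost (2 + l) m + k * (5 * k * groupCost 2 m) →
                s * ⌊log₂ n ⌋ ≤ 192 * n * 2 ^ n
    sizeBound {s} size = begin
      s * ⌊log₂ n ⌋                                             ≤⟨ ℕₚ.*-monoʳ-≤ s log<6k ⟩
      s * (6 * k)                                               ≡⟨ pull s k ⟩
      6 * (s * k)                                               ≤⟨ ℕₚ.*-monoʳ-≤ 6 size ⟩
      6 * (2 ^ n * groupCost (2 + l) m + k * (5 * k * groupCost 2 m))
        ≤⟨ ℕₚ.*-monoʳ-≤ 6 (ℕₚ.+-mono-≤ (ℕₚ.*-monoʳ-≤ (2 ^ n) cost) (ℕₚ.*-monoʳ-≤ k (ℕₚ.*-monoʳ-≤ (5 * k) cost₂))) ⟩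
      6 * (2 ^ n * (13 * m) + k * (5 * k * (13 * m)))           ≡⟨ regroup (2 ^ n) m k ⟩
      6 * (13 * 2 ^ n + 13 * (5 * (k * k))) * m                 ≤⟨ ℕₚ.*-mono-≤ (ℕₚ.*-monoʳ-≤ 6 (ℕₚ.+-monoʳ-≤ (13 * 2 ^ n) tail)) (ℕₚ.+-monoʳ-≤ n p≤n) ⟩
      6 * (13 * 2 ^ n + 3 * 2 ^ n) * (n + n)                    ≡⟨ final (2 ^ n) n ⟩
      192 * n * 2 ^ n ∎
      where
      open ℕₚ.≤-Reasoning
      pull : ∀ s k → s * (6 * k) ≡ 6 * (s * k)
      pull = solve-∀
      regroup : ∀ y m k → 6 * (y * (13 * m) + k * (5 * k * (13 * m))) ≡ 6 * (13 * y + 13 * (5 * (k * k))) * m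
      regroup = solve-∀
      final : ∀ y n → 6 * (13 * y + 3 * y) * (n + n) ≡ 192 * n * y
      final = solve-∀

-- The bound on the Shannon function

relax : ∀ {s b} k → s ≤ b → s * suc k ≤ (suc k + 1) * b
relax {s} {b} k s≤b = begin
  s * suc k         ≤⟨ ℕₚ.*-monoˡ-≤ (suc k) s≤b ⟩
  b * suc k         ≡⟨ ℕₚ.*-comm b (suc k) ⟩
  suc k * b         ≤⟨ ℕₚ.*-monoˡ-≤ b (ℕₚ.m≤m+n (suc k) 1) ⟩
  (suc k + 1) * b ∎
  where open ℕₚ.≤-Reasoning

-- For `q ≤ n` the given circuit, whatever its length, supplies the even word that prescribes the
-- targets. For larger `q` the universal word on `2 n` lines does so, and the remaining lines are
-- left untouched.
shannonBound : ∀ {n q f} → Scale n → InF n q f →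
               Σ (Circuit (n + q)) λ C → Implements n q C f × complexity C * ⌊log₂ n ⌋ ≤ 192 * n * 2 ^ n
shannonBound {n} {q} {f} S (C , implements) = decide (q ℕ.≤? n)
  where
  open Scale S
  wide : ∀ p → 4 + l ≤ n + p
  wide p = ℕₚ.≤-trans (4+l≤n S) (ℕₚ.m≤m+n n p)
  Bounded : ℕ → Set
  Bounded p = Σ (Circuit (n + p)) λ C → Implements n p C f × complexity C * ⌊log₂ n ⌋ ≤ 192 * n * 2 ^ n
  fromWord : ∀ {p} → p ≤ n → (∃ λ (w : Word (n + p)) → Proper w × odd w ≡ false × (∀ x → take n (act w (pad p x)) ≡ f x)) →
             Bounded p
  fromWord {p} p≤n (w , proper , even , computes) = bound (synthesizeImplementation {l = l} (wide p) w proper even computes)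
    where
    bound : (Σ (Circuit (n + p)) λ C → Implements n p C f × length C * 2 ^ suc l ≤
               2 ^ n * groupCost (2 + l) (n + p) + 2 ^ suc l * (5 * 2 ^ suc l * groupCost 2 (n + p))) → Bounded p
    bound (D , computesD , size) = D , computesD , sizeBound S p≤n {length D} size
  fromCircuit : EvenWord (run C) → ∃ λ (w : Word (n + q)) → Proper w × odd w ≡ false × (∀ x → take n (act w (pad q x)) ≡ f x)
  fromCircuit (w , proper , even , acts) = w , proper , even , λ x → trans (cong (take n) (acts (pad q x))) (implements x)
  widen : n ≤ q → Bounded n → Bounded q
  widen n≤q (D , computesD , size) = lifted (implements-mono n≤q D computesD)
    where
    lifted : (Σ (Circuit (n + q)) λ E → Implements n q E f × length E ≡ length D) → Bounded q
    lifted (E , computesE , len) = E , computesE ,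
      subst (λ a → a * ⌊log₂ n ⌋ ≤ 192 * n * 2 ^ n) (sym len) size
  decide : Dec (q ≤ n) → Bounded q
  decide (yes q≤n) = fromWord q≤n (fromCircuit (evenCircuit (ℕₚ.≤-trans (ℕₚ.m≤m+n 4 l) (wide q)) C))
  decide (no q≰n)  = widen (ℕₚ.<⇒≤ (ℕₚ.≰⇒> q≰n)) (fromWord ℕₚ.≤-refl (universalWord (ℕₚ.≤-trans (s≤s z≤n) (4+l≤n S)) f))

theorem1 : (q : ℕ → ℕ) (k : ℕ) → Σ ℕ (λ N → (n : ℕ) → n ≥ N → (f : Vec Bool n → Vec Bool n) → InF n (q n) f →
    Σ (Circuit (n + q n)) (λ C → Implements n (q n) C f ×
    complexity C * ⌊log₂ n ⌋ * suc k ≤ (suc k + 1) * (192 * n * 2 ^ n)))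
-- From this threshold on the bound holds without any error term, so the factor `1 + 1 / suc k` is
-- simply given away.
theorem1 q k = 2 ^ 48 , λ n n≥N f f∈F → relaxed (shannonBound (scale 48 n ℕₚ.≤-refl n≥N) f∈F)
  where
  relaxed : ∀ {n f} → (Σ (Circuit (n + q n)) λ C → Implements n (q n) C f × complexity C * ⌊log₂ n ⌋ ≤ 192 * n * 2 ^ n) →
            Σ (Circuit (n + q n)) (λ C → Implements n (q n) C f ×
              complexity C * ⌊log₂ n ⌋ * suc k ≤ (suc k + 1) * (192 * n * 2 ^ n))
  relaxed (C , computes , size) = C , computes , relax k size
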